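{- As formal power series in $z$, \[ \sum_{n\ge0}\sum_{\pi\in\mathcal S_n}p^{\mathrm{des}(\pi)}q^{\mathrm{asc}(\pi)}x^{\mathrm{cyc}(\pi)}z^{n} =\cfrac{1}{1-xz-\cfrac{qxz^{2}}{1-(q+p+x)z-\cfrac{2q(p+x)z^{2}}{1-(2q+2p+x)z-\cfrac{3q(2p+x)z^{2}}{1-(3q+3p+x)z-\cdots}}}}, \] i.e. the continued fraction whose $h$-th level ($h\ge0$) has denominator $1-(hq+hp+x)z$ and whose $h$-th partial numerator is $(h+1)q(hp+x)z^2$.
   Context: $\mathcal S_n$ is the set of permutations of $[n]=\{1,\dots,n\}$; $\mathcal S_0$ consists of the empty permutation (0 cycles, 0 ascents, 0 descents). The standard cycle form of $\pi$ writes each cycle starting with its smallest element and lists cycles in decreasing order of their smallest elements. $\Psi(\pi)$ is the word obtained by deleting the parentheses from the standard cycle form. $\mathrm{cyc}(\pi)$ is the number of cycles. A cyclic ascent (resp. descent) of $\pi$ is a position $i$ such that $\Psi(\pi)_i$ and $\Psi(\pi)_{i+1}$ lie in the same cycle and $\Psi(\pi)_i<\Psi(\pi)_{i+1}$ (resp. $>$); $\mathrm{asc}(\pi)$ and $\mathrm{des}(\pi)$ count them. -}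

module Defs where

open import Data.Nat using (ℕ; zero; suc) renaming (_+_ to _+ℕ_)
open import Data.Nat using ( _≤ᵇ_; _≡ᵇ_; _<ᵇ_)
open import Data.Bool using (Bool; true; false; if_then_else_; _∧_; not)
open import Data.List using (List; []; _∷_; map; concatMap; concat; length; _++_)
open import Algebra.Bundles using (CommutativeSemiring)

-- Permutations of [n] = {1,…,n} in one-line notation:
-- a list σ of length n with σ[i-1] = π(i).

-- π(i) for the permutation σ (0 outside [n])
app : List ℕ → ℕ → ℕ
app []       _             = 0
app (a ∷ as) zero          = 0
app (a ∷ as) (suc zero)    = a
app (a ∷ as) (suc (suc k)) = app as (suc k)

range : ℕ → List ℕ
range zero    = []
range (suc n) = range n ++ (suc n ∷ [])

rangeDown : ℕ → List ℕ
rangeDown zero    = []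
rangeDown (suc n) = suc n ∷ rangeDown n

words : ℕ → ℕ → List (List ℕ)
words n zero    = [] ∷ []
words n (suc k) = concatMap (λ w → map (λ a → a ∷ w) (range n)) (words n k)

elem : ℕ → List ℕ → Bool
elem a []       = false
elem a (b ∷ bs) = if a ≡ᵇ b then true else elem a bs

distinct : List ℕ → Bool
distinct []       = true
distinct (a ∷ as) = not (elem a as) ∧ distinct as

filterᵇ : {A : Set} → (A → Bool) → List A → List A
filterᵇ P []       = []
filterᵇ P (a ∷ as) = if P a then a ∷ filterᵇ P as else filterᵇ P as

-- 𝒮ₙ : all bijections [n] → [n] (injective words of length n over [n]),
-- each listed exactly once.
Perms : ℕ → List (List ℕ)
Perms n = filterᵇ distinct (words n n)

orbitGo : List ℕ → ℕ → ℕ → ℕ → List ℕ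
orbitGo σ m k zero    = []
orbitGo σ m k (suc f) = if k ≡ᵇ m then [] else k ∷ orbitGo σ m (app σ k) f

cycleOf : List ℕ → ℕ → List ℕ
cycleOf σ m = m ∷ orbitGo σ m (app σ m) (length σ)

isCycleMin : List ℕ → ℕ → Bool
isCycleMin σ m = allᵇ (cycleOf σ m)
  where
  allᵇ : List ℕ → Bool
  allᵇ []       = true
  allᵇ (a ∷ as) = (m ≤ᵇ a) ∧ allᵇ as

standardCycleForm : List ℕ → List (List ℕ)
standardCycleForm σ = map (cycleOf σ) (filterᵇ (isCycleMin σ) (rangeDown (length σ)))

Ψ : List ℕ → List ℕ
Ψ σ = concat (standardCycleForm σ)

sameCycle : List ℕ → ℕ → ℕ → Bool
sameCycle σ a b = elem b (cycleOf σ a)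

cyc : List ℕ → ℕ
cyc σ = length (standardCycleForm σ)

ascWord : List ℕ → List ℕ → ℕ
ascWord σ []           = 0
ascWord σ (a ∷ [])     = 0
ascWord σ (a ∷ b ∷ ws) =
  (if sameCycle σ a b ∧ (a <ᵇ b) then 1 else 0) +ℕ ascWord σ (b ∷ ws)

desWord : List ℕ → List ℕ → ℕ
desWord σ []           = 0
desWord σ (a ∷ [])     = 0
desWord σ (a ∷ b ∷ ws) =
  (if sameCycle σ a b ∧ (b <ᵇ a) then 1 else 0) +ℕ desWord σ (b ∷ ws)

asc : List ℕ → ℕ
asc σ = ascWord σ (Ψ σ)

des : List ℕ → ℕ
des σ = desWord σ (Ψ σ)

-- Generating functions with coefficients in an arbitrary commutative
-- semiring R (the identity is a polynomial identity in p, q, x, i.e. one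
-- in ℕ[p,q,x], the free commutative semiring on p, q, x).

module _ {c ℓ} (R : CommutativeSemiring c ℓ) where
  open CommutativeSemiring R

  pow : Carrier → ℕ → Carrier
  pow r zero    = 1#
  pow r (suc k) = r * pow r k

  nmul : ℕ → Carrier → Carrier
  nmul zero    r = 0#
  nmul (suc h) r = r + nmul h r

  sumR : List Carrier → Carrier
  sumR []       = 0#
  sumR (a ∷ as) = a + sumR as

  permGF : Carrier → Carrier → Carrier → ℕ → Carrier
  permGF p q x n =
    sumR (map (λ σ → (pow p (des σ) * pow q (asc σ)) * pow x (cyc σ)) (Perms n))

  FPS : Set c
  FPS = ℕ → Carrier

  oneS : FPS
  oneS zero    = 1#
  oneS (suc n) = 0#

  dotFrom : FPS → ℕ → List Carrier → Carrier
  dotFrom g k []       = 0#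
  dotFrom g k (s ∷ ss) = g k * s + dotFrom g (suc k) ss

  -- coefficients [S_n, …, S_0] of S = 1/(1 - g), for g with g_0 = 0
  -- (g_0 is ignored): S_0 = 1, S_{n+1} = Σ_{k=1}^{n+1} g_k S_{n+1-k}
  invList : FPS → ℕ → List Carrier
  invList g zero    = 1# ∷ []
  invList g (suc n) = dotFrom g 1 (invList g n) ∷ invList g n

  headOr : List Carrier → Carrier
  headOr []      = 0#
  headOr (a ∷ _) = a

  invOneMinus : FPS → FPS
  invOneMinus g n = headOr (invList g n)

  level : Carrier → Carrier → FPS → FPS
  level b lam f zero          = 0#
  level b lam f (suc zero)    = b
  level b lam f (suc (suc k)) = lam * f k

  bCoef : Carrier → Carrier → Carrier → ℕ → Carrier
  bCoef p q x h = (nmul h q + nmul h p) + x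

  lamCoef : Carrier → Carrier → Carrier → ℕ → Carrier
  lamCoef p q x h = nmul (suc h) q * (nmul h p + x)

  cfTrunc : Carrier → Carrier → Carrier → ℕ → ℕ → FPS
  cfTrunc p q x zero    h = oneS
  cfTrunc p q x (suc d) h =
    invOneMinus (level (bCoef p q x h) (lamCoef p q x h) (cfTrunc p q x d (suc h)))

{-# OPTIONS --safe #-}
module Submission where

open import Defs
open import Algebra.Bundles using (CommutativeSemiring)
open import Algebra.Structures.Biased using (isCommutativeSemiringˡ)
import Algebra.Solver.Ring.NaturalCoefficients.Default as Solver
open import Data.Bool using (Bool; true; false; T; if_then_else_; _∧_)
open import Data.Bool.Properties using (T?; T-∧; T-≡; ⇔→≡)
open import Data.Empty using (⊥-elim)
open import Data.Fin using (Fin; toℕ)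
open import Data.Fin.Properties using (pigeonhole; toℕ<n)
open import Data.Nat using (ℕ; zero; suc; _≤_; _<_; z≤n; s≤s; _≤ᵇ_; _≡ᵇ_; _<ᵇ_; _≟_) renaming (_+_ to _+ℕ_)
open import Data.Nat.GeneralisedArithmetic using (iterate)
open import Data.Nat.Properties as ℕ using (suc-injective; ≤-refl; ≤-trans; ≤-reflexive; ≤-antisym; ≤-pred; ≤∧≢⇒<; m≤n⇒m≤1+n; 1+n≰n; 1+n≢n; _≤?_; ≰⇒>; ≮⇒≥; ≤⇒≯; <-asym; m≤n+m; m≤n⇒∃[o]m+o≡n; ≡ᵇ⇒≡; ≡⇒≡ᵇ; ≤ᵇ⇒≤; ≤⇒≤ᵇ; <ᵇ⇒<; <⇒<ᵇ)
open import Data.Nat.Induction using (<-rec)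
open import Data.List using (List; []; _∷_; _∷ʳ_; [_]; map; concat; concatMap; foldr; length; _++_; filter; cartesianProductWith; initLast; _∷ʳ′_; lookup)
open import Data.List.Properties using (map-++; ∷ʳ-injective; map-cong; map-cong-local; map-id; map-∘; map-injective; length-++; length-map)
open import Data.List.Reverse using (Reverse; reverseView; []; _∶_∶ʳ_)
open import Data.List.Membership.Propositional using (_∈_; _∉_)
open import Data.List.Membership.Propositional.Properties using (∈-map⁺; ∈-map⁻; ∈-++⁺ˡ; ∈-++⁺ʳ; ∈-++⁻; ∈-∃++; ∈-concat⁺′; ∈-concat⁻′; ∈-cartesianProductWith⁺; ∈-cartesianProductWith⁻; ∈-filter⁺; ∈-filter⁻)
open import Data.List.Membership.Propositional.Properties.WithK using (unique∧set⇒bag)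
open import Data.List.Relation.Binary.BagAndSetEquality using (∼bag⇒↭)
open import Data.List.Relation.Binary.Subset.Propositional using (_⊆_)
open import Data.List.Relation.Binary.Disjoint.Propositional using (Disjoint)
open import Data.List.Relation.Binary.Permutation.Propositional using (_↭_; ↭-refl; ↭-sym; ↭-trans; ↭-prep; ↭-reflexive; ↭⇒↭ₛ; ↭⇒↭ₛ′; module PermutationReasoning)
import Data.List.Relation.Binary.Permutation.Propositional.Properties as ↭
import Data.List.Relation.Binary.Permutation.Setoid.Properties as ↭ₛ
open import Data.List.Relation.Unary.All as All using (All; []; _∷_)
import Data.List.Relation.Unary.All.Properties as All
open import Data.List.Relation.Unary.Any using (here; there; index)
open import Data.List.Relation.Unary.Any.Properties using (lookup-index)
open import Data.List.Relation.Unary.AllPairs as AllPairs using (AllPairs; []; _∷_)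
import Data.List.Relation.Unary.AllPairs.Properties as AllPairs
open import Data.List.Relation.Unary.Unique.Propositional using (Unique)
import Data.List.Relation.Unary.Unique.Propositional.Properties as Unique
open import Data.Product using (_×_; _,_; proj₁; proj₂; ∃; ∃₂)
open import Data.Product.Relation.Binary.Pointwise.NonDependent using (Pointwise; ×-isEquivalence)
open import Data.Sum as Sum using (_⊎_; inj₁; inj₂)
open import Data.Unit using (tt)
open import Function using (case_of_; _∘_; id; mk⇔; Equivalence)
open import Relation.Binary.Construct.Closure.ReflexiveTransitive using (Star; ε; _◅_; _◅◅_)
open import Relation.Binary.PropositionalEquality as ≡ using (_≡_; _≢_; refl; sym; trans; cong; cong₂; subst)
import Relation.Binary.Reasoning.Setoid as SetoidReasoning
open import Relation.Nullary using (Dec; yes; no; ¬_; contradiction)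

-- Let δ be the derivation with δp = δq = pq and δx = qx, and let Pₙ be the
-- polynomial of Sₙ. The weight of a permutation is a product over its letters i:
-- q if i < σ(i), x if σ(i) is the minimum of its cycle, p otherwise. Inserting
-- n+1 between i and σ(i) applies δ to the factor of i, and n+1 as a fixed point
-- gives a factor x, so Pₙ₊₁ = x Pₙ + δPₙ. Let M n h be the weighted count of
-- Motzkin paths from height h to 0. The coefficients satisfy
-- λ_{h-1} + δb_h = λ_h and b_h λ_h + δλ_h = λ_h b_{h+1}, whence
-- δ (M n h) = λ_h M n (h+1) by induction on n; for h = 0 this is the same
-- recursion, so Pₙ = M n 0, which is the continued fraction. The derivation is
-- realised over an arbitrary semiring by evaluating in its dual numbers.

-- A semiring `R` need not carry any map with p to pq, so δ is not an operation on `R`. It acts on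
-- polynomial expressions, and its value is the ε-part of the same expression evaluated in the dual
-- numbers. Applying δ to an equation thus means using that equation over another semiring. This is
-- why both sides are compared over all semirings at once: the induction step over R calls the
-- hypothesis over `dualNumbers R`. The values of δ come from the insertion. When n+1 goes between i
-- and σ(i), the arrow out of i becomes an ascent, with factor q, and the new arrow from n+1 to σ(i)
-- has factor x if σ(i) is the minimum of its cycle and p otherwise. An ascent never ends in a cycle
-- minimum, so the old factors q and p both become qp, and x becomes qx. The arrow back to a cycle
-- minimum carries x because it is not an adjacent pair of Ψ and each cycle has exactly one. The
-- infinite fraction enters through its truncations: a path of length n climbs at most n levels, so
-- depth N fixes the coefficients up to z^N.

-- R[ε]/(ε²), with (a , b) standing for a + b ε.
module _ {c ℓ} (R : CommutativeSemiring c ℓ) where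
  open CommutativeSemiring R renaming (refl to ≈-refl; sym to ≈-sym; trans to ≈-trans)
  open Solver R using (solve; con; _:+_; _:*_; _:=_)

  dualNumbers : CommutativeSemiring c ℓ
  dualNumbers = record
    { Carrier = Carrier × Carrier
    ; _≈_ = Pointwise _≈_ _≈_
    ; _+_ = λ (a , b) (a′ , b′) → a + a′ , b + b′
    ; _*_ = λ (a , b) (a′ , b′) → a * a′ , a * b′ + b * a′
    ; 0# = 0# , 0#
    ; 1# = 1# , 0#
    ; isCommutativeSemiring = isCommutativeSemiringˡ record
      { +-isCommutativeMonoid = record
        { isMonoid = record
          { isSemigroup = record
            { isMagma = record
              { isEquivalence = isEquiv
              ; ∙-cong = λ (e , f) (e′ , f′) → +-cong e e′ , +-cong f f′
              }
            ; assoc = λ _ _ _ → +-assoc _ _ _ , +-assoc _ _ _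
            }
          ; identity = (λ _ → +-identityˡ _ , +-identityˡ _) , (λ _ → +-identityʳ _ , +-identityʳ _)
          }
        ; comm = λ _ _ → +-comm _ _ , +-comm _ _
        }
      ; *-isCommutativeMonoid = record
        { isMonoid = record
          { isSemigroup = record
            { isMagma = record
              { isEquivalence = isEquiv
              ; ∙-cong = λ (e , f) (e′ , f′) →
                  *-cong e e′ , +-cong (*-cong e f′) (*-cong f e′)
              }
            ; assoc = λ (a , b) (a′ , b′) (a″ , b″) → *-assoc _ _ _ ,
                solve 6 (λ a b a′ b′ a″ b″ →
                  (a :* a′) :* b″ :+ (a :* b′ :+ b :* a′) :* a″ :=
                  a :* (a′ :* b″ :+ b′ :* a″) :+ b :* (a′ :* a″)) ≈-refl a b a′ b′ a″ b″
            }
          ; identity =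
              (λ (a , b) → *-identityˡ _ ,
                solve 2 (λ a b → con 1 :* b :+ con 0 :* a := b) ≈-refl a b) ,
              (λ (a , b) → *-identityʳ _ ,
                solve 2 (λ a b → a :* con 0 :+ b :* con 1 := b) ≈-refl a b)
          }
        ; comm = λ (a , b) (a′ , b′) → *-comm _ _ ,
            solve 4 (λ a b a′ b′ → a :* b′ :+ b :* a′ := a′ :* b :+ b′ :* a) ≈-refl a b a′ b′
        }
      ; distribʳ = λ (a , b) (a′ , b′) (a″ , b″) → distribʳ _ _ _ ,
          solve 6 (λ a b a′ b′ a″ b″ →
            (a′ :+ a″) :* b :+ (b′ :+ b″) :* a :=
            (a′ :* b :+ b′ :* a) :+ (a″ :* b :+ b″ :* a)) ≈-refl a b a′ b′ a″ b″
      ; zeroˡ = λ (a , b) → zeroˡ _ ,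
          solve 2 (λ a b → con 0 :* b :+ con 0 :* a := con 0) ≈-refl a b
      }
    }
    where isEquiv = ×-isEquivalence isEquivalence isEquivalence

  -- Makes the multiple of r a product with the single element `nmul R h 1#`, so that the semiring
  -- solver can treat the level h as an indeterminate H.
  nmul-linear : ∀ h r → nmul R h r ≈ nmul R h 1# * r
  nmul-linear zero    r = ≈-sym (zeroˡ r)
  nmul-linear (suc h) r = ≈-trans (+-cong (≈-sym (*-identityˡ r)) (nmul-linear h r))
                                (≈-sym (distribʳ r 1# (nmul R h 1#)))

-- Motzkin path polynomials and the derivation δ

module _ {c ℓ} (R : CommutativeSemiring c ℓ) (p q x : CommutativeSemiring.Carrier R) where
  open CommutativeSemiring R renaming (refl to ≈-refl; sym to ≈-sym; trans to ≈-trans)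
  private
    b = bCoef R p q x
    lam = lamCoef R p q x

  -- Weighted Motzkin paths of length n from height h to height 0, decomposed
  -- by their first step; down steps have weight 1.
  motzkin : ℕ → ℕ → Carrier
  motzkin zero    zero    = 1#
  motzkin zero    (suc h) = 0#
  motzkin (suc n) zero    = b 0 * motzkin n 0 + lam 0 * motzkin n 1
  motzkin (suc n) (suc h) =
    motzkin n h + (b (suc h) * motzkin n (suc h) + lam (suc h) * motzkin n (suc (suc h)))

-- The ε-part of a value at (p + pq ε , q + pq ε , x + qx ε) is the value of the
-- derivation δ with δp = δq = pq and δx = qx.
module _ {c ℓ} (R : CommutativeSemiring c ℓ) (p q x : CommutativeSemiring.Carrier R) where
  open CommutativeSemiring R renaming (refl to ≈-refl; sym to ≈-sym; trans to ≈-trans)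
  open Solver R using (solve; con; _:+_; _:*_; _:=_)
  open SetoidReasoning setoid

  private
    Rε = dualNumbers R
    module Rε = CommutativeSemiring Rε
    b = bCoef R p q x
    lam = lamCoef R p q x
    M = motzkin R p q x

  pε qε xε : Rε.Carrier
  pε = p , q * p
  qε = q , q * p
  xε = x , q * x

  private
    bε = bCoef Rε pε qε xε
    lamε = lamCoef Rε pε qε xε
    Mε = motzkin Rε pε qε xε

  nmul-dual : ∀ h r s → nmul Rε h (r , s) ≡ (nmul R h r , nmul R h s)
  nmul-dual zero    r s = refl
  nmul-dual (suc h) r s = cong ((r , s) Rε.+_) (nmul-dual h r s)

  bCoef-value : ∀ h → proj₁ (bε h) ≡ b h
  bCoef-value h rewrite nmul-dual h q (q * p) | nmul-dual h p (q * p) = refl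

  lamCoef-value : ∀ h → proj₁ (lamε h) ≡ lam h
  lamCoef-value h rewrite nmul-dual h q (q * p) | nmul-dual h p (q * p) = refl

  private
    nmul-lin = nmul-linear R

  -- The lowest case of `δb`, with λ at level -1 read as 0.
  δb₀ : proj₂ (bε 0) ≈ lam 0
  δb₀ = solve 3 (λ p q x → (con 0 :+ con 0) :+ q :* x := (q :+ con 0) :* (con 0 :+ x)) ≈-refl p q x

  -- Both λ_{h+1} - λ_h and δb_{h+1} equal 2(h+1)pq + qx. The identity is kept additive because a
  -- semiring has no subtraction.
  δb : ∀ h → lam h + proj₂ (bε (suc h)) ≈ lam (suc h)
  δb h rewrite nmul-dual h q (q * p) | nmul-dual h p (q * p) = begin
    (q + nmul R h q) * (nmul R h p + x) + (((q * p + nmul R h (q * p)) + (q * p + nmul R h (q * p))) + q * x)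
      ≈⟨ +-cong (*-cong (+-congˡ (nmul-lin h q)) (+-congʳ (nmul-lin h p)))
                (+-congʳ (+-cong (+-congˡ (nmul-lin h (q * p))) (+-congˡ (nmul-lin h (q * p))))) ⟩
    (q + H * q) * (H * p + x) + (((q * p + H * (q * p)) + (q * p + H * (q * p))) + q * x)
      ≈⟨ solve 4 (λ H p q x →
           (q :+ H :* q) :* (H :* p :+ x) :+ (((q :* p :+ H :* (q :* p)) :+ (q :* p :+ H :* (q :* p))) :+ q :* x)
           := (q :+ (q :+ H :* q)) :* ((p :+ H :* p) :+ x)) ≈-refl H p q x ⟩
    (q + (q + H * q)) * ((p + H * p) + x)
      ≈⟨ *-cong (+-congˡ (+-congˡ (nmul-lin h q))) (+-congʳ (+-congˡ (nmul-lin h p))) ⟨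
    lam (suc h) ∎
    where H = nmul R h 1#

  -- The two factors of λ_h are eigenvectors of δ: (h+1)q is multiplied by p, and hp + x by q. Hence
  -- δλ_h = (p + q)λ_h, and p + q is the difference b_{h+1} - b_h.
  δlam : ∀ h → b h * lam h + proj₂ (lamε h) ≈ lam h * b (suc h)
  δlam h rewrite nmul-dual h q (q * p) | nmul-dual h p (q * p) = begin
    ((nmul R h q + nmul R h p) + x) * ((q + nmul R h q) * (nmul R h p + x)) +
      ((q + nmul R h q) * (nmul R h (q * p) + q * x) + (q * p + nmul R h (q * p)) * (nmul R h p + x))
      ≈⟨ +-cong (*-cong (+-congʳ (+-cong (nmul-lin h q) (nmul-lin h p)))
                        (*-cong (+-congˡ (nmul-lin h q)) (+-congʳ (nmul-lin h p))))
           (+-cong (*-cong (+-congˡ (nmul-lin h q)) (+-congʳ (nmul-lin h (q * p))))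
                   (*-cong (+-congˡ (nmul-lin h (q * p))) (+-congʳ (nmul-lin h p)))) ⟩
    ((H * q + H * p) + x) * ((q + H * q) * (H * p + x)) +
      ((q + H * q) * (H * (q * p) + q * x) + (q * p + H * (q * p)) * (H * p + x))
      ≈⟨ solve 4 (λ H p q x →
           ((H :* q :+ H :* p) :+ x) :* ((q :+ H :* q) :* (H :* p :+ x)) :+
             ((q :+ H :* q) :* (H :* (q :* p) :+ q :* x) :+ (q :* p :+ H :* (q :* p)) :* (H :* p :+ x))
           := ((q :+ H :* q) :* (H :* p :+ x)) :* (((q :+ H :* q) :+ (p :+ H :* p)) :+ x)) ≈-refl H p q x ⟩
    ((q + H * q) * (H * p + x)) * (((q + H * q) + (p + H * p)) + x)
      ≈⟨ *-cong (*-cong (+-congˡ (nmul-lin h q)) (+-congʳ (nmul-lin h p)))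
                (+-congʳ (+-cong (+-congˡ (nmul-lin h q)) (+-congˡ (nmul-lin h p)))) ⟨
    lam h * b (suc h) ∎
    where H = nmul R h 1#

  motzkin-value : ∀ n h → proj₁ (Mε n h) ≈ M n h
  motzkin-value zero    zero    = ≈-refl
  motzkin-value zero    (suc h) = ≈-refl
  motzkin-value (suc n) zero    =
    +-cong (*-cong (reflexive (bCoef-value 0)) (motzkin-value n 0))
           (*-cong (reflexive (lamCoef-value 0)) (motzkin-value n 1))
  motzkin-value (suc n) (suc h) =
    +-cong (motzkin-value n h)
      (+-cong (*-cong (reflexive (bCoef-value (suc h))) (motzkin-value n (suc h)))
              (*-cong (reflexive (lamCoef-value (suc h))) (motzkin-value n (suc (suc h)))))

  -- The product rule is applied to the first-step recursion and the result is sorted by paths of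
  -- length n. At height h+1, λ_h from the induction hypothesis joins δb_{h+1} and gives λ_{h+1}; at
  -- height h+2, `δlam` gives λ_{h+1} b_{h+2}. What appears is λ_{h+1} times the recursion at height
  -- h+2.
  δmotzkin : ∀ n h → proj₂ (Mε n h) ≈ lam h * M n (suc h)
  δmotzkin zero    zero    = ≈-sym (zeroʳ _)
  δmotzkin zero    (suc h) = ≈-sym (zeroʳ _)
  δmotzkin (suc n) zero    = begin
    (proj₁ (bε 0) * proj₂ (Mε n 0) + proj₂ (bε 0) * proj₁ (Mε n 0)) +
      (proj₁ (lamε 0) * proj₂ (Mε n 1) + proj₂ (lamε 0) * proj₁ (Mε n 1))
      ≈⟨ +-cong (+-cong (*-congˡ (δmotzkin n 0)) (*-cong δb₀ (motzkin-value n 0)))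
                (+-cong (*-congˡ (δmotzkin n 1)) (*-congˡ (motzkin-value n 1))) ⟩
    (b 0 * (lam 0 * M n 1) + lam 0 * M n 0) + (lam 0 * (lam 1 * M n 2) + lamε₂ * M n 1)
      ≈⟨ solve 7 (λ b l l₁ d m₀ m₁ m₂ →
           (b :* (l :* m₁) :+ l :* m₀) :+ (l :* (l₁ :* m₂) :+ d :* m₁)
           := l :* m₀ :+ ((b :* l :+ d) :* m₁ :+ l :* (l₁ :* m₂)))
           ≈-refl (b 0) (lam 0) (lam 1) lamε₂ (M n 0) (M n 1) (M n 2) ⟩
    lam 0 * M n 0 + ((b 0 * lam 0 + lamε₂) * M n 1 + lam 0 * (lam 1 * M n 2))
      ≈⟨ +-congˡ (+-congʳ (*-congʳ (δlam 0))) ⟩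
    lam 0 * M n 0 + ((lam 0 * b 1) * M n 1 + lam 0 * (lam 1 * M n 2))
      ≈⟨ solve 6 (λ b l l₁ m₀ m₁ m₂ →
           l :* m₀ :+ ((l :* b) :* m₁ :+ l :* (l₁ :* m₂)) := l :* (m₀ :+ (b :* m₁ :+ l₁ :* m₂)))
           ≈-refl (b 1) (lam 0) (lam 1) (M n 0) (M n 1) (M n 2) ⟩
    lam 0 * M (suc n) 1 ∎
    where lamε₂ = proj₂ (lamε 0)
  δmotzkin (suc n) (suc h) = begin
    proj₂ (Mε n h) +
      ((proj₁ (bε h₁) * proj₂ (Mε n h₁) + proj₂ (bε h₁) * proj₁ (Mε n h₁)) +
       (proj₁ (lamε h₁) * proj₂ (Mε n h₂) + proj₂ (lamε h₁) * proj₁ (Mε n h₂)))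
      ≈⟨ +-cong (δmotzkin n h)
           (+-cong (+-cong (*-cong (reflexive (bCoef-value h₁)) (δmotzkin n h₁)) (*-congˡ (motzkin-value n h₁)))
                   (+-cong (*-cong (reflexive (lamCoef-value h₁)) (δmotzkin n h₂)) (*-congˡ (motzkin-value n h₂)))) ⟩
    lam h * M n h₁ +
      ((b h₁ * (lam h₁ * M n h₂) + bε₂ * M n h₁) + (lam h₁ * (lam h₂ * M n h₃) + lamε₂ * M n h₂))
      ≈⟨ solve 9 (λ b l l₁ l₂ d d′ m₁ m₂ m₃ →
           l :* m₁ :+ ((b :* (l₁ :* m₂) :+ d′ :* m₁) :+ (l₁ :* (l₂ :* m₃) :+ d :* m₂))
           := (l :+ d′) :* m₁ :+ ((b :* l₁ :+ d) :* m₂ :+ l₁ :* (l₂ :* m₃)))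
           ≈-refl (b h₁) (lam h) (lam h₁) (lam h₂) lamε₂ bε₂ (M n h₁) (M n h₂) (M n h₃) ⟩
    (lam h + bε₂) * M n h₁ + ((b h₁ * lam h₁ + lamε₂) * M n h₂ + lam h₁ * (lam h₂ * M n h₃))
      ≈⟨ +-cong (*-congʳ (δb h)) (+-congʳ (*-congʳ (δlam h₁))) ⟩
    lam h₁ * M n h₁ + ((lam h₁ * b h₂) * M n h₂ + lam h₁ * (lam h₂ * M n h₃))
      ≈⟨ solve 6 (λ b l l₁ m₀ m₁ m₂ →
           l :* m₀ :+ ((l :* b) :* m₁ :+ l :* (l₁ :* m₂)) := l :* (m₀ :+ (b :* m₁ :+ l₁ :* m₂)))
           ≈-refl (b h₂) (lam h₁) (lam h₂) (M n h₁) (M n h₂) (M n h₃) ⟩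
    lam h₁ * M (suc n) h₂ ∎
    where
    h₁ = suc h
    h₂ = suc h₁
    h₃ = suc h₂
    bε₂ = proj₂ (bε h₁)
    lamε₂ = proj₂ (lamε h₁)

  motzkin-suc : ∀ n → M (suc n) 0 ≈ x * M n 0 + proj₂ (Mε n 0)
  motzkin-suc n = +-cong (*-congʳ (≈-trans (+-congʳ (+-identityˡ 0#)) (+-identityˡ x)))
                         (≈-sym (δmotzkin n 0))

-- Cauchy products and the series 1/(1 - g)

module _ {c ℓ} (R : CommutativeSemiring c ℓ) where
  open CommutativeSemiring R renaming (refl to ≈-refl; sym to ≈-sym; trans to ≈-trans)
  open Solver R using (solve; _:+_; _:*_; _:=_)
  open SetoidReasoning setoid

  -- Multiplication by z.
  shiftS : FPS R → FPS R
  shiftS u zero    = 0#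
  shiftS u (suc n) = u n

  -- The Cauchy product, by recursion that splits the left factor as a 0 plus z times its tail.
  conv : FPS R → FPS R → FPS R
  conv a u zero    = a 0 * u 0
  conv a u (suc n) = a 0 * u (suc n) + conv (λ k → a (suc k)) u n

  conv-cong : ∀ {a a′ u u′} → (∀ n → a n ≈ a′ n) → (∀ n → u n ≈ u′ n) →
              ∀ n → conv a u n ≈ conv a′ u′ n
  conv-cong a≈ u≈ zero    = *-cong (a≈ 0) (u≈ 0)
  conv-cong a≈ u≈ (suc n) =
    +-cong (*-cong (a≈ 0) (u≈ (suc n))) (conv-cong (λ k → a≈ (suc k)) u≈ n)

  conv-linearˡ : ∀ r s a a′ u n →
                 conv (λ k → r * a k + s * a′ k) u n ≈ r * conv a u n + s * conv a′ u n
  conv-linearˡ r s a a′ u zero    =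
    solve 5 (λ r s a a′ u → (r :* a :+ s :* a′) :* u := r :* (a :* u) :+ s :* (a′ :* u))
      ≈-refl r s (a 0) (a′ 0) (u 0)
  conv-linearˡ r s a a′ u (suc n) = ≈-trans
    (+-congˡ (conv-linearˡ r s (λ k → a (suc k)) (λ k → a′ (suc k)) u n))
    (solve 7 (λ r s a a′ u v v′ →
        (r :* a :+ s :* a′) :* u :+ (r :* v :+ s :* v′)
        := r :* (a :* u :+ v) :+ s :* (a′ :* u :+ v′))
      ≈-refl r s (a 0) (a′ 0) (u (suc n)) (conv (λ k → a (suc k)) u n) (conv (λ k → a′ (suc k)) u n))

  conv-scaleˡ : ∀ r a u n → conv (λ k → r * a k) u n ≈ r * conv a u n
  conv-scaleˡ r a u zero    = *-assoc _ _ _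
  conv-scaleˡ r a u (suc n) =
    ≈-trans (+-cong (*-assoc _ _ _) (conv-scaleˡ r (λ k → a (suc k)) u n)) (≈-sym (distribˡ _ _ _))

  -- With a⁺ the tail of a, the tail of the product a u is a₀ u⁺ + a⁺ u. Linearity in the left
  -- factor then reduces the claim to a⁺.
  conv-assoc : ∀ a u v n → conv (conv a u) v n ≈ conv a (conv u v) n
  conv-assoc a u v zero    = *-assoc _ _ _
  conv-assoc a u v (suc n) = begin
    (a 0 * u 0) * v (suc n) + conv (λ k → a 0 * u (suc k) + conv a⁺ u k) v n
      -- The factor `1#` only brings the sum into the shape of `conv-linearˡ`.
      ≈⟨ +-congˡ (conv-cong (λ k → +-congˡ (≈-sym (*-identityˡ _))) (λ _ → ≈-refl) n) ⟩
    (a 0 * u 0) * v (suc n) + conv (λ k → a 0 * u (suc k) + 1# * conv a⁺ u k) v n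
      ≈⟨ +-congˡ (conv-linearˡ (a 0) 1# (λ k → u (suc k)) (conv a⁺ u) v n) ⟩
    (a 0 * u 0) * v (suc n) + (a 0 * conv (λ k → u (suc k)) v n + 1# * conv (conv a⁺ u) v n)
      ≈⟨ +-congˡ (+-congˡ (≈-trans (*-identityˡ _) (conv-assoc a⁺ u v n))) ⟩
    (a 0 * u 0) * v (suc n) + (a 0 * conv (λ k → u (suc k)) v n + conv a⁺ (conv u v) n)
      ≈⟨ solve 5 (λ a u v w s → (a :* u) :* v :+ (a :* w :+ s) := a :* (u :* v :+ w) :+ s)
           ≈-refl (a 0) (u 0) (v (suc n)) (conv (λ k → u (suc k)) v n) (conv a⁺ (conv u v) n) ⟩
    a 0 * (u 0 * v (suc n) + conv (λ k → u (suc k)) v n) + conv a⁺ (conv u v) n ∎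
    where a⁺ = λ k → a (suc k)

  conv-shiftˡ : ∀ a u n → conv (shiftS a) u n ≈ shiftS (conv a u) n
  conv-shiftˡ a u zero    = zeroˡ _
  conv-shiftˡ a u (suc n) = ≈-trans (+-congʳ (zeroˡ _)) (+-identityˡ _)

  conv-shiftʳ-suc : ∀ a u n → conv a (shiftS u) (suc n) ≈ conv a u n
  conv-shiftʳ-suc a u zero    = ≈-trans (+-congˡ (zeroʳ _)) (+-identityʳ _)
  conv-shiftʳ-suc a u (suc n) = +-congˡ (conv-shiftʳ-suc (λ k → a (suc k)) u n)

  dotFrom-suc : ∀ a k l → dotFrom R a (suc k) l ≡ dotFrom R (λ j → a (suc j)) k l
  dotFrom-suc a k []      = refl
  dotFrom-suc a k (s ∷ l) = cong (a (suc k) * s +_) (dotFrom-suc a (suc k) l)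

  -- `invList` runs from S_n down to S_0, so pairing it with the ascending coefficients of a is a
  -- Cauchy product.
  dotFrom-invList : ∀ g a n → dotFrom R a 0 (invList R g n) ≈ conv a (invOneMinus R g) n
  dotFrom-invList g a zero    = +-identityʳ _
  dotFrom-invList g a (suc n) =
    +-congˡ (≈-trans (reflexive (dotFrom-suc a 0 (invList R g n)))
                   (dotFrom-invList g (λ k → a (suc k)) n))

  -- The coefficient of z^(n+1) in S = 1 + bzS + λz²fS. One z of the last term is absorbed by the
  -- index and the other stays as `shiftS S`, so that one formula also covers n = 0.
  invOneMinus-level : ∀ b lam f n → let S = invOneMinus R (level R b lam f) in
                      S (suc n) ≈ b * S n + lam * conv f (shiftS S) n
  invOneMinus-level b lam f n = begin
    S (suc n)
      ≈⟨ reflexive (dotFrom-suc g 0 (invList R g n)) ⟩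
    dotFrom R (λ k → g (suc k)) 0 (invList R g n)
      ≈⟨ dotFrom-invList g (λ k → g (suc k)) n ⟩
    conv (λ k → g (suc k)) S n
      ≈⟨ lemma n ⟩
    b * S n + lam * conv f (shiftS S) n ∎
    where
    g = level R b lam f
    S = invOneMinus R g
    lemma : ∀ n → conv (λ k → g (suc k)) S n ≈ b * S n + lam * conv f (shiftS S) n
    lemma zero    = ≈-sym (≈-trans (+-congˡ (≈-trans (*-congˡ (zeroʳ _)) (zeroʳ _))) (+-identityʳ _))
    lemma (suc n) = +-congˡ (≈-trans (conv-scaleˡ lam f S n) (*-congˡ (≈-sym (conv-shiftʳ-suc f S n))))

-- The truncated fraction counts Motzkin paths

module _ {c ℓ} (R : CommutativeSemiring c ℓ) (p q x : CommutativeSemiring.Carrier R) where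
  open CommutativeSemiring R renaming (refl to ≈-refl; sym to ≈-sym; trans to ≈-trans)
  open SetoidReasoning setoid
  private
    b = bCoef R p q x
    lam = lamCoef R p q x
    C = cfTrunc R p q x
    M = motzkin R p q x
    _⋆_ = conv R

  -- A path from height h to 0 is cut at its first passages to h-1, …, 0.
  descent : ℕ → ℕ → FPS R
  descent d zero    = C d 0
  descent d (suc h) = C d (suc h) ⋆ shiftS R (descent (suc d) h)

  cfTrunc-suc : ∀ d h n →
    C (suc d) h (suc n) ≈ b h * C (suc d) h n + lam h * (C d (suc h) ⋆ shiftS R (C (suc d) h)) n
  cfTrunc-suc d h = invOneMinus-level R (b h) (lam h) (C d (suc h))

  -- The leading factor C₁ equals 1 + z(b C₁ + λ C₂ z C₁). Its three terms are a first step down,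
  -- level, or up; the up term gains one more first-passage factor C₂. Depth and height change
  -- oppositely, so their sum, the height at which the fraction is cut off, stays fixed.
  descent-suc : ∀ d h n →
    descent (suc d) (suc h) (suc n) ≈
    descent (suc (suc d)) h n +
      (b (suc h) * descent (suc d) (suc h) n + lam (suc h) * descent d (suc (suc h)) n)
  descent-suc d h n = begin
    1# * U n + (λ k → C₁ (suc k)) ⋆⟨ n ⟩
      ≈⟨ +-cong (*-identityˡ _) (conv-cong R (cfTrunc-suc d (suc h)) (λ _ → ≈-refl) n) ⟩
    U n + (λ k → b (suc h) * C₁ k + lam (suc h) * (C₂ ⋆ shiftS R C₁) k) ⋆⟨ n ⟩
      ≈⟨ +-congˡ (conv-linearˡ R (b (suc h)) (lam (suc h)) C₁ (C₂ ⋆ shiftS R C₁) (shiftS R U) n) ⟩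
    U n + (b (suc h) * C₁ ⋆⟨ n ⟩ + lam (suc h) * (C₂ ⋆ shiftS R C₁) ⋆⟨ n ⟩)
      ≈⟨ +-congˡ (+-congˡ (*-congˡ (≈-trans (conv-assoc R C₂ (shiftS R C₁) (shiftS R U) n)
           (conv-cong R (λ _ → ≈-refl) (conv-shiftˡ R C₁ (shiftS R U)) n)))) ⟩
    U n + (b (suc h) * descent (suc d) (suc h) n + lam (suc h) * descent d (suc (suc h)) n) ∎
    where
    U = descent (suc (suc d)) h
    C₁ = C (suc d) (suc h)
    C₂ = C d (suc (suc h))
    infix 8 _⋆⟨_⟩
    _⋆⟨_⟩ : FPS R → ℕ → Carrier
    a ⋆⟨ n ⟩ = (a ⋆ shiftS R U) n

  cfTrunc-zero : ∀ d h → C d h 0 ≈ 1#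
  cfTrunc-zero zero    h = ≈-refl
  cfTrunc-zero (suc d) h = ≈-refl

  -- Both sides satisfy the same first-step recursion. Each step uses up one unit of length and at
  -- most one of depth, so n ≤ d persists and depth 0 is met only with length 0, where the
  -- truncation is exact.
  motzkin≈descent : ∀ n d h → n ≤ d → M n h ≈ descent d h n
  motzkin≈descent zero    d       zero    _         = ≈-sym (cfTrunc-zero d 0)
  motzkin≈descent zero    d       (suc h) _         = ≈-sym (zeroʳ _)
  motzkin≈descent (suc n) (suc d) zero    (s≤s n≤d) = ≈-trans
    (+-cong (*-congˡ (motzkin≈descent n (suc d) 0 (m≤n⇒m≤1+n n≤d)))
            (*-congˡ (motzkin≈descent n d 1 n≤d)))
    (≈-sym (cfTrunc-suc d 0 n))
  motzkin≈descent (suc n) (suc d) (suc h) (s≤s n≤d) = ≈-trans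
    (+-cong (motzkin≈descent n (suc (suc d)) h (m≤n⇒m≤1+n (m≤n⇒m≤1+n n≤d)))
      (+-cong (*-congˡ (motzkin≈descent n (suc d) (suc h) (m≤n⇒m≤1+n n≤d)))
              (*-congˡ (motzkin≈descent n d (suc (suc h)) n≤d))))
    (≈-sym (descent-suc d h n))

-- Duplicate-free lists

Unique-resp-↭ : ∀ {A : Set} {xs ys : List A} → xs ↭ ys → Unique xs → Unique ys
Unique-resp-↭ {A} p = ↭ₛ.Unique-resp-↭ (≡.setoid A) (↭⇒↭ₛ p)

unique-⊆-⊇⇒↭ : ∀ {A : Set} {xs ys : List A} → Unique xs → Unique ys → xs ⊆ ys → ys ⊆ xs → xs ↭ ys
unique-⊆-⊇⇒↭ uxs uys xs⊆ys ys⊆xs = ∼bag⇒↭ (unique∧set⇒bag uxs uys (mk⇔ xs⊆ys ys⊆xs))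

-- Counting replaces the reverse inclusion: deleting the head of `xs` from both lists preserves all
-- hypotheses.
unique-⊆-length⇒↭ : ∀ {A : Set} {xs ys : List A} →
                    Unique xs → xs ⊆ ys → length xs ≡ length ys → xs ↭ ys
unique-⊆-length⇒↭ {xs = []}     {[]} _ _ _ = ↭-refl
unique-⊆-length⇒↭ {xs = x ∷ xs} {ys} (x∉xs ∷ uxs) xs⊆ys len
  with ∈-∃++ (xs⊆ys (here refl))
... | us , vs , refl = ↭-trans (↭-prep x xs↭) (↭-sym moved)
  where
  moved = ↭.shift x us vs
  sub : xs ⊆ us ++ vs
  sub z∈xs with ↭.∈-resp-↭ moved (xs⊆ys (there z∈xs))
  ... | here refl = contradiction refl (All.lookup x∉xs z∈xs)
  ... | there z∈  = z∈
  xs↭ : xs ↭ us ++ vs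
  xs↭ = unique-⊆-length⇒↭ uxs sub (suc-injective (trans len (↭.↭-length moved)))

∈-range⁺ : ∀ {n i} → 1 ≤ i → i ≤ n → i ∈ range n
∈-range⁺ {zero}  1≤i i≤0 = contradiction (≤-trans 1≤i i≤0) λ ()
∈-range⁺ {suc n} {i} 1≤i i≤1+n with i ≟ suc n
... | yes refl = ∈-++⁺ʳ (range n) (here refl)
... | no i≢    = ∈-++⁺ˡ (∈-range⁺ 1≤i (≤-pred (≤∧≢⇒< i≤1+n i≢)))

∈-range⁻ : ∀ {n i} → i ∈ range n → 1 ≤ i × i ≤ n
∈-range⁻ {suc n} i∈ with ∈-++⁻ (range n) i∈
... | inj₁ i∈n = let 1≤i , i≤n = ∈-range⁻ i∈n in 1≤i , m≤n⇒m≤1+n i≤n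
... | inj₂ (here refl) = s≤s z≤n , ≤-refl

range-unique : ∀ n → Unique (range n)
range-unique zero    = []
range-unique (suc n) = Unique.++⁺ (range-unique n) ([] ∷ [])
  λ { (1+n∈ , here refl) → 1+n≰n (proj₂ (∈-range⁻ {n} 1+n∈)) }

length-range : ∀ n → length (range n) ≡ n
length-range zero    = refl
length-range (suc n) = trans (length-++ (range n)) (trans (ℕ.+-comm _ 1) (cong suc (length-range n)))

∈-rangeDown⁻ : ∀ {k i} → i ∈ rangeDown k → 1 ≤ i × i ≤ k
∈-rangeDown⁻ {suc k} (here refl) = s≤s z≤n , ≤-refl
∈-rangeDown⁻ {suc k} (there i∈)  = let 1≤i , i≤k = ∈-rangeDown⁻ i∈ in 1≤i , m≤n⇒m≤1+n i≤k

∈-rangeDown⁺ : ∀ {k i} → 1 ≤ i → i ≤ k → i ∈ rangeDown k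
∈-rangeDown⁺ {zero}  1≤i i≤0 = contradiction (≤-trans 1≤i i≤0) λ ()
∈-rangeDown⁺ {suc k} {i} 1≤i i≤1+k with i ≟ suc k
... | yes refl = here refl
... | no i≢    = there (∈-rangeDown⁺ 1≤i (≤-pred (≤∧≢⇒< i≤1+k i≢)))

rangeDown-unique : ∀ k → Unique (rangeDown k)
rangeDown-unique zero    = []
rangeDown-unique (suc k) =
  All.tabulate (λ i∈ → λ { refl → 1+n≰n (proj₂ (∈-rangeDown⁻ {k} i∈)) }) ∷ rangeDown-unique k

-- Enumeration of permutations

filterᵇ≡filter : ∀ {A : Set} (P : A → Bool) xs → filterᵇ P xs ≡ filter (T? ∘ P) xs
filterᵇ≡filter P []       = refl
filterᵇ≡filter P (a ∷ as) with P a
... | true  = cong (a ∷_) (filterᵇ≡filter P as)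
... | false = filterᵇ≡filter P as

elem⇒∈ : ∀ {a} bs → T (elem a bs) → a ∈ bs
elem⇒∈ {a} (b ∷ bs) h with a ≡ᵇ b in eq
... | true  = here (≡ᵇ⇒≡ a b (subst T (sym eq) tt))
... | false = there (elem⇒∈ bs h)

∈⇒elem : ∀ {a bs} → a ∈ bs → T (elem a bs)
∈⇒elem {a} {b ∷ bs} a∈ with a ≡ᵇ b in eq
∈⇒elem a∈ | true = tt
∈⇒elem {a} (here refl) | false = ⊥-elim (subst T eq (≡⇒≡ᵇ a a refl))
∈⇒elem (there a∈) | false = ∈⇒elem a∈

distinct⇒Unique : ∀ σ → T (distinct σ) → Unique σ
distinct⇒Unique []      _ = []
distinct⇒Unique (a ∷ σ) h with elem a σ in eq
... | false = All.tabulate (λ b∈ → λ { refl → subst T eq (∈⇒elem b∈) }) ∷ distinct⇒Unique σ h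

Unique⇒distinct : ∀ {σ} → Unique σ → T (distinct σ)
Unique⇒distinct [] = tt
Unique⇒distinct {a ∷ σ} (a∉ ∷ u) with elem a σ in eq
... | false = Unique⇒distinct u
... | true  = contradiction refl (All.lookup a∉ (elem⇒∈ σ (subst T (sym eq) tt)))

words-suc : ∀ n k → words n (suc k) ≡ cartesianProductWith (λ w a → a ∷ w) (words n k) (range n)
words-suc n k = go (words n k)
  where
  go : ∀ ws → concatMap (λ w → map (_∷ w) (range n)) ws ≡ cartesianProductWith (λ w a → a ∷ w) ws (range n)
  go []       = refl
  go (w ∷ ws) = cong (map (_∷ w) (range n) ++_) (go ws)

words-unique : ∀ n k → Unique (words n k)
words-unique n zero    = [] ∷ []
words-unique n (suc k) rewrite words-suc n k =
  Unique.cartesianProductWith⁺ _ (λ { refl → refl , refl }) (words-unique n k) (range-unique n)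

∈-words⁺ : ∀ {n w} → All (_∈ range n) w → w ∈ words n (length w)
∈-words⁺ [] = here refl
∈-words⁺ {n} {a ∷ w} (a∈ ∷ w∈) rewrite words-suc n (length w) =
  ∈-cartesianProductWith⁺ (λ w a → a ∷ w) (∈-words⁺ w∈) a∈

∈-words⁻ : ∀ {n k w} → w ∈ words n k → length w ≡ k × All (_∈ range n) w
∈-words⁻ {n} {zero}  (here refl) = refl , []
∈-words⁻ {n} {suc k} w∈ rewrite words-suc n k
  with ∈-cartesianProductWith⁻ (λ w a → a ∷ w) (words n k) (range n) w∈
... | w , a , w∈ , a∈ , refl = let len , all = ∈-words⁻ w∈ in cong suc len , a∈ ∷ all

Perms-unique : ∀ n → Unique (Perms n)
Perms-unique n rewrite filterᵇ≡filter distinct (words n n) =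
  Unique.filter⁺ (T? ∘ distinct) (words-unique n n)

∈-Perms⁻ : ∀ {n σ} → σ ∈ Perms n → σ ↭ range n
∈-Perms⁻ {n} {σ} σ∈ rewrite filterᵇ≡filter distinct (words n n) =
  let σ∈w , d = ∈-filter⁻ (T? ∘ distinct) σ∈
      len , all = ∈-words⁻ {n} {n} σ∈w
  in unique-⊆-length⇒↭ (distinct⇒Unique σ d) (All.lookup all) (trans len (sym (length-range n)))

∈-Perms⁺ : ∀ {n σ} → σ ↭ range n → σ ∈ Perms n
∈-Perms⁺ {n} {σ} σ↭ rewrite filterᵇ≡filter distinct (words n n) =
  ∈-filter⁺ (T? ∘ distinct)
    (subst (λ k → σ ∈ words n k) (trans (↭.↭-length σ↭) (length-range n))
      (∈-words⁺ (All.tabulate (↭.∈-resp-↭ σ↭))))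
    (Unique⇒distinct (Unique-resp-↭ (↭-sym σ↭) (range-unique n)))

-- Insertion of the largest element

transp : ℕ → ℕ → ℕ → ℕ
transp v w a with a ≟ v
... | yes _ = w
... | no _ with a ≟ w
...   | yes _ = v
...   | no _  = a

transp-left : ∀ v w → transp v w v ≡ w
transp-left v w with v ≟ v
... | yes _  = refl
... | no v≢v = contradiction refl v≢v

transp-right : ∀ v w → transp v w w ≡ v
transp-right v w with w ≟ v
... | yes w≡v = w≡v
... | no _ with w ≟ w
...   | yes _  = refl
...   | no w≢w = contradiction refl w≢w

transp-other : ∀ {v w a} → a ≢ v → a ≢ w → transp v w a ≡ a
transp-other {v} {w} {a} a≢v a≢w with a ≟ v
... | yes a≡v = contradiction a≡v a≢v
... | no _ with a ≟ w
...   | yes a≡w = contradiction a≡w a≢w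
...   | no _    = refl

transp-involutive : ∀ v w a → transp v w (transp v w a) ≡ a
transp-involutive v w a with a ≟ v
... | yes refl = transp-right v w
... | no a≢v with a ≟ w
...   | yes refl = transp-left v w
...   | no a≢w   = transp-other a≢v a≢w

transp-injective : ∀ v w {a b} → transp v w a ≡ transp v w b → a ≡ b
transp-injective v w {a} {b} eq =
  trans (sym (transp-involutive v w a)) (trans (cong (transp v w) eq) (transp-involutive v w b))

transp-∈ : ∀ {v w a l} → v ∈ l → w ∈ l → a ∈ l → transp v w a ∈ l
transp-∈ {v} {w} {a} v∈ w∈ a∈ with a ≟ v
... | yes _ = w∈
... | no _ with a ≟ w
...   | yes _ = v∈
...   | no _  = a∈

-- In cycle notation: N is inserted just before v, or as a fixed point if v = N.
insert : ℕ → List ℕ → ℕ → List ℕ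
insert N σ v = map (transp v N) σ ∷ʳ v

insert-injective : ∀ N {σ σ′ v v′} → insert N σ v ≡ insert N σ′ v′ → σ ≡ σ′ × v ≡ v′
insert-injective N {σ} {σ′} {v} eq with ∷ʳ-injective (map (transp v N) σ) _ eq
... | eq′ , refl = map-injective (transp-injective v N) eq′ , refl

-- The appended v is the image of the fixed point N under the transposition. So insertion is left
-- multiplication of the extended σ by (v N), which can be undone.
insert≡map : ∀ N σ v → insert N σ v ≡ map (transp v N) (σ ∷ʳ N)
insert≡map N σ v = trans (cong (map (transp v N) σ ∷ʳ_) (sym (transp-right v N)))
                         (sym (map-++ (transp v N) σ [ N ]))

transp-range : ∀ {n v} → v ∈ range (suc n) → map (transp v (suc n)) (range (suc n)) ↭ range (suc n)
transp-range {n} {v} v∈ = unique-⊆-length⇒↭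
  (Unique.map⁺ (transp-injective v (suc n)) (range-unique (suc n)))
  (λ a∈ → let b , b∈ , eq = ∈-map⁻ (transp v (suc n)) a∈ in
    subst (_∈ range (suc n)) (sym eq) (transp-∈ v∈ (∈-range⁺ (s≤s z≤n) ≤-refl) b∈))
  (length-map _ (range (suc n)))

insert-perm : ∀ {n σ v} → σ ↭ range n → v ∈ range (suc n) → insert (suc n) σ v ↭ range (suc n)
insert-perm {n} {σ} {v} σ↭ v∈ = ↭-trans (↭-reflexive (insert≡map (suc n) σ v))
  (↭-trans (↭.map⁺ (transp v (suc n)) (↭.++⁺ʳ [ suc n ] σ↭)) (transp-range v∈))

-- The last entry of τ has to be v, and the transposition is its own inverse.
insert-surjective : ∀ {n τ} → τ ↭ range (suc n) →
                    ∃₂ λ σ v → σ ↭ range n × v ∈ range (suc n) × τ ≡ insert (suc n) σ v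
insert-surjective {n} {τ} τ↭ with initLast τ
... | [] = contradiction (trans (↭.↭-length τ↭) (length-range (suc n))) λ ()
... | w ∷ʳ′ v = σ , v , σ↭ , v∈ , cong (_∷ʳ v) (sym undo)
  where
  t = transp v (suc n)
  σ = map t w
  v∈ : v ∈ range (suc n)
  v∈ = ↭.∈-resp-↭ τ↭ (∈-++⁺ʳ w (here refl))
  undo : map t σ ≡ w
  undo = trans (sym (map-∘ w)) (trans (map-cong (transp-involutive v (suc n)) w) (map-id w))
  σ↭ : σ ↭ range n
  -- The transposition turns τ into σ followed by n+1 and permutes 1, ..., n+1; cancelling n+1
  -- leaves σ.
  σ↭ = ↭.drop-∷ (begin
    suc n ∷ σ        ↭⟨ ↭.∷↭∷ʳ (suc n) σ ⟩
    σ ∷ʳ suc n       ≡⟨ cong (σ ∷ʳ_) (transp-left v (suc n)) ⟨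
    σ ∷ʳ t v         ≡⟨ map-++ t w [ v ] ⟨
    map t (w ∷ʳ v)   ↭⟨ ↭.map⁺ t τ↭ ⟩
    map t (range (suc n)) ↭⟨ transp-range v∈ ⟩
    range n ∷ʳ suc n ↭⟨ ↭.∷↭∷ʳ (suc n) (range n) ⟨
    suc n ∷ range n  ∎)
    where open PermutationReasoning

Perms-suc : ∀ n → Perms (suc n) ↭ cartesianProductWith (insert (suc n)) (Perms n) (range (suc n))
Perms-suc n = unique-⊆-⊇⇒↭ (Perms-unique (suc n))
  (Unique.cartesianProductWith⁺ (insert (suc n)) (insert-injective (suc n)) (Perms-unique n) (range-unique (suc n)))
  (λ τ∈ → let σ , v , σ↭ , v∈ , eq = insert-surjective (∈-Perms⁻ {suc n} τ∈) in
    subst (_∈ cartesianProductWith (insert (suc n)) (Perms n) (range (suc n))) (sym eq)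
      (∈-cartesianProductWith⁺ (insert (suc n)) (∈-Perms⁺ {n} σ↭) v∈))
  (λ τ∈ → let σ , v , σ∈ , v∈ , eq = ∈-cartesianProductWith⁻ (insert (suc n)) (Perms n) (range (suc n)) τ∈ in
    subst (_∈ Perms (suc n)) (sym eq) (∈-Perms⁺ {suc n} (insert-perm (∈-Perms⁻ {n} σ∈) v∈)))

-- Orbits and cycles

app-∷ʳ : ∀ {σ v j} → j ≤ length σ → app (σ ∷ʳ v) j ≡ app σ j
app-∷ʳ {[]}        {j = zero}        _       = refl
app-∷ʳ {a ∷ σ}     {j = zero}        _       = refl
app-∷ʳ {a ∷ σ}     {j = suc zero}    _       = refl
app-∷ʳ {a ∷ σ} {v} {j = suc (suc j)} (s≤s h) = app-∷ʳ {σ} {v} {suc j} h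

app-last : ∀ σ v → app (σ ∷ʳ v) (suc (length σ)) ≡ v
app-last []      v = refl
app-last (a ∷ σ) v = app-last σ v

app-map : ∀ (t : ℕ → ℕ) {σ j} → 1 ≤ j → j ≤ length σ → app (map t σ) j ≡ t (app σ j)
app-map t {a ∷ σ} {suc zero}    _ _       = refl
app-map t {a ∷ σ} {suc (suc j)} _ (s≤s h) = app-map t {σ} {suc j} (s≤s z≤n) h

map-app-range : ∀ σ → map (app σ) (range (length σ)) ≡ σ
map-app-range σ = go (reverseView σ)
  where
  open ≡.≡-Reasoning
  go : ∀ {σ} → Reverse σ → map (app σ) (range (length σ)) ≡ σ
  go [] = refl
  go (w ∶ rw ∶ʳ v) = begin
    map (app (w ∷ʳ v)) (range (length (w ∷ʳ v)))
      ≡⟨ cong (map (app (w ∷ʳ v)) ∘ range) (trans (length-++ w) (ℕ.+-comm _ 1)) ⟩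
    map (app (w ∷ʳ v)) (range (length w) ∷ʳ suc (length w))
      ≡⟨ map-++ (app (w ∷ʳ v)) (range (length w)) _ ⟩
    map (app (w ∷ʳ v)) (range (length w)) ∷ʳ app (w ∷ʳ v) (suc (length w))
      ≡⟨ cong₂ _∷ʳ_ (map-cong-local (All.tabulate {xs = range (length w)} λ j∈ →
                       app-∷ʳ {w} (proj₂ (∈-range⁻ j∈))))
                    (app-last w v) ⟩
    map (app w) (range (length w)) ∷ʳ v
      ≡⟨ cong (_∷ʳ v) (go rw) ⟩
    w ∷ʳ v ∎

Reach : (ℕ → ℕ) → ℕ → ℕ → Set
Reach f = Star (λ a b → f a ≡ b)

-- The trajectory of a under f up to, but excluding, its first visit to m: a fuel-free account of
-- what `orbitGo` computes, suited to induction.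
data Chain (f : ℕ → ℕ) (m : ℕ) : ℕ → List ℕ → Set where
  stop : Chain f m m []
  step : ∀ {a w} → a ≢ m → Chain f m (f a) w → Chain f m a (a ∷ w)

module _ {f : ℕ → ℕ} {m : ℕ} where

  chain-functional : ∀ {a u v} → Chain f m a u → Chain f m a v → u ≡ v
  chain-functional stop       stop       = refl
  chain-functional stop       (step x≢ _) = contradiction refl x≢
  chain-functional (step x≢ _) stop       = contradiction refl x≢
  chain-functional (step _ c) (step _ d) = cong (_ ∷_) (chain-functional c d)

  chain-suffix : ∀ {a b w} → Chain f m a w → b ∈ w → ∃ λ v → Chain f m b v × length v ≤ length w
  chain-suffix c@(step _ _) (here refl) = _ , c , ≤-refl
  chain-suffix (step _ c)   (there b∈)  =
    let v , d , v≤ = chain-suffix c b∈ in v , d , m≤n⇒m≤1+n v≤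

  -- If a recurred in w, the suffix starting there would be a chain from a no longer than w; but the
  -- only chain from a is a ∷ w.
  chain-fresh : ∀ {a w} → a ≢ m → Chain f m (f a) w → a ∉ w
  chain-fresh a≢m c a∈w with chain-suffix c a∈w
  ... | v , d , v≤ with refl ← chain-functional (step a≢m c) d = 1+n≰n v≤

  chain-unique : ∀ {a w} → Chain f m a w → Unique w
  chain-unique stop = []
  chain-unique (step a≢m c) =
    All.tabulate (λ b∈ → λ { refl → chain-fresh a≢m c b∈ }) ∷ chain-unique c

  chain-≢ : ∀ {a b w} → Chain f m a w → b ∈ w → b ≢ m
  chain-≢ (step a≢m _) (here refl) = a≢m
  chain-≢ (step _ c)   (there b∈)  = chain-≢ c b∈

  chain-start : ∀ {a w} → Chain f m a w → a ∈ m ∷ w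
  chain-start stop       = here refl
  chain-start (step _ _) = there (here refl)

  chain-closed : ∀ {a b w} → Chain f m a w → b ∈ w → f b ∈ m ∷ w
  chain-closed (step _ c) (here refl) with chain-start c
  ... | here eq   = here eq
  ... | there fb∈ = there (there fb∈)
  chain-closed (step _ c) (there b∈) with chain-closed c b∈
  ... | here eq   = here eq
  ... | there fb∈ = there (there fb∈)

  chain-reach : ∀ {a b w} → Chain f m a w → b ∈ w → Reach f a b
  chain-reach (step _ _) (here refl) = ε
  chain-reach (step _ c) (there b∈)  = refl ◅ chain-reach c b∈

  chain-end : ∀ {a w} → Chain f m a w → Reach f a m
  chain-end stop       = ε
  chain-end (step _ c) = refl ◅ chain-end c

-- Any visit to m within the fuel is enough, since an earlier one only stops the walk sooner. With
-- no fuel left the start is m itself, so the empty output is right.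
orbitGo-chain : ∀ σ m j fuel {k} → j ≤ fuel → iterate (app σ) k j ≡ m →
                Chain (app σ) m k (orbitGo σ m k fuel)
orbitGo-chain σ m zero    zero       _       refl = stop
orbitGo-chain σ m j       (suc fuel) {k} j≤  eq with k ≡ᵇ m in e
orbitGo-chain σ m j       (suc fuel) {k} j≤  eq | true
  with refl ← ≡ᵇ⇒≡ k m (subst T (sym e) tt) = stop
orbitGo-chain σ m zero    (suc fuel) {k} j≤  eq | false = ⊥-elim (subst T e (≡⇒≡ᵇ k m eq))
orbitGo-chain σ m (suc j) (suc fuel) {k} (s≤s j≤) eq | false =
  step (λ k≡m → subst T e (≡⇒≡ᵇ k m k≡m)) (orbitGo-chain σ m j fuel j≤ eq)

allGe : ℕ → List ℕ → Bool
allGe m []       = true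
allGe m (a ∷ as) = (m ≤ᵇ a) ∧ allGe m as

allGe⇒≤ : ∀ {m b} as → T (allGe m as) → b ∈ as → m ≤ b
allGe⇒≤ {m} (a ∷ as) h (here refl) = ≤ᵇ⇒≤ m a (proj₁ (Equivalence.to T-∧ h))
allGe⇒≤ {m} (a ∷ as) h (there b∈) = allGe⇒≤ as (proj₂ (Equivalence.to (T-∧ {m ≤ᵇ a}) h)) b∈

≤⇒allGe : ∀ {m} as → (∀ {b} → b ∈ as → m ≤ b) → T (allGe m as)
≤⇒allGe []       h = tt
≤⇒allGe (a ∷ as) h = Equivalence.from T-∧ (≤⇒≤ᵇ (h (here refl)) , ≤⇒allGe as (h ∘ there))

¬allGe⇒< : ∀ {m} as → ¬ T (allGe m as) → ∃ λ b → b ∈ as × b < m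
¬allGe⇒< []       h = contradiction tt h
¬allGe⇒< {m} (a ∷ as) h with m ≤? a
... | no m≰a = a , here refl , ≰⇒> m≰a
... | yes m≤a =
  let b , b∈ , b<m = ¬allGe⇒< as (λ t → h (Equivalence.from T-∧ (≤⇒≤ᵇ m≤a , t))) in b , there b∈ , b<m

allGe-characterised : ∀ {m} {F : List ℕ → Bool} → F [] ≡ true →
                      (∀ a as → F (a ∷ as) ≡ (m ≤ᵇ a) ∧ F as) → ∀ as → F as ≡ allGe m as
allGe-characterised nil cons []       = nil
allGe-characterised nil cons (a ∷ as) =
  trans (cons a as) (cong (_ ∧_) (allGe-characterised nil cons as))

-- The local function in the definition of isCycleMin has no name here: it is
-- captured by unification, which needs the metavariable to be created outside
-- the scope of w.
isCycleMin≡allGe : ∀ σ m → isCycleMin σ m ≡ allGe m (cycleOf σ m)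
isCycleMin≡allGe σ m with allGe-characterised {m} {_} | orbitGo σ m (app σ m) (length σ)
... | characterised | w = cong ((m ≤ᵇ m) ∧_) (characterised refl (λ _ _ → refl) w)

iterate-suc : ∀ (f : ℕ → ℕ) a k → iterate f (f a) k ≡ f (iterate f a k)
iterate-suc f a zero    = refl
iterate-suc f a (suc k) = iterate-suc f (f a) k

module Orbits {n : ℕ} {σ : List ℕ} (σ↭ : σ ↭ range n) where

  private f = app σ

  length≡ : length σ ≡ n
  length≡ = trans (↭.↭-length σ↭) (length-range n)

  map-app : map f (range n) ≡ σ
  map-app = subst (λ k → map f (range k) ≡ σ) length≡ (map-app-range σ)

  app-∈ : ∀ {i} → i ∈ range n → f i ∈ range n
  app-∈ i∈ = ↭.∈-resp-↭ σ↭ (subst (_ ∈_) map-app (∈-map⁺ f i∈))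

  app-injective : ∀ {i j} → i ∈ range n → j ∈ range n → f i ≡ f j → i ≡ j
  app-injective = unique-map⇒injective (subst Unique (sym map-app) (Unique-resp-↭ (↭-sym σ↭) (range-unique n)))
    where
    unique-map⇒injective : ∀ {l i j} → Unique (map f l) → i ∈ l → j ∈ l → f i ≡ f j → i ≡ j
    unique-map⇒injective u       (here refl) (here refl) eq = refl
    unique-map⇒injective (x∉ ∷ u) (here refl) (there j∈)  eq =
      contradiction eq (All.lookup x∉ (∈-map⁺ f j∈))
    unique-map⇒injective (x∉ ∷ u) (there i∈)  (here refl) eq =
      contradiction (sym eq) (All.lookup x∉ (∈-map⁺ f i∈))
    unique-map⇒injective (_ ∷ u) (there i∈)  (there j∈)  eq = unique-map⇒injective u i∈ j∈ eq

  iterate-∈ : ∀ {m} k → m ∈ range n → iterate f m k ∈ range n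
  iterate-∈ zero    m∈ = m∈
  iterate-∈ (suc k) m∈ = iterate-∈ k (app-∈ m∈)

  iterate-cancel : ∀ i k {m} → m ∈ range n → iterate f m i ≡ iterate f m (i +ℕ k) → m ≡ iterate f m k
  iterate-cancel zero    k m∈ eq = eq
  iterate-cancel (suc i) k {m} m∈ eq = app-injective m∈ (iterate-∈ k m∈)
    (trans (iterate-cancel i k (app-∈ m∈) eq) (iterate-suc f m k))

  -- Pigeonhole: the n+1 iterates m, f m, ..., fⁿ m take at most n values, so two agree, and
  -- injectivity cancels their common prefix. The bound on j keeps the return within the fuel
  -- `length σ`.
  returns : ∀ {m} → m ∈ range n → ∃ λ j → j ≤ n × iterate f (f m) j ≡ m
  returns {m} m∈ with pigeonhole (s≤s (≤-reflexive (length-range n))) position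
    where
    position : Fin (suc n) → Fin (length (range n))
    position k = index (iterate-∈ (toℕ k) m∈)
  ... | i , j , i<j , eq with m≤n⇒∃[o]m+o≡n i<j
  ...   | k , sum = k , k≤n , sym (iterate-cancel (toℕ i) (suc k) m∈ same)
    where
    sum′ : toℕ i +ℕ suc k ≡ toℕ j
    sum′ = trans (ℕ.+-suc (toℕ i) k) sum
    same : iterate f m (toℕ i) ≡ iterate f m (toℕ i +ℕ suc k)
    same = trans (lookup-index (iterate-∈ (toℕ i) m∈))
      (trans (cong (lookup (range n)) eq)
      (trans (sym (lookup-index (iterate-∈ (toℕ j) m∈))) (cong (iterate f m) (sym sum′))))
    k≤n : k ≤ n
    k≤n = ≤-trans (m≤n+m k (toℕ i)) (≤-pred (≤-trans (≤-reflexive sum) (m≤n⇒m≤1+n (≤-pred (toℕ<n j)))))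

  cycle-chain : ∀ {m} → m ∈ range n → Chain f m (f m) (orbitGo σ m (f m) (length σ))
  cycle-chain {m} m∈ = let j , j≤n , eq = returns m∈ in
    orbitGo-chain σ m j (length σ) (≤-trans j≤n (≤-reflexive (sym length≡))) eq

  ∈-cycle⇒reach : ∀ {m b} → m ∈ range n → b ∈ cycleOf σ m → Reach f m b
  ∈-cycle⇒reach m∈ (here refl) = ε
  ∈-cycle⇒reach m∈ (there b∈)  = refl ◅ chain-reach (cycle-chain m∈) b∈

  reach⇒∈-cycle : ∀ {m b} → m ∈ range n → Reach f m b → b ∈ cycleOf σ m
  reach⇒∈-cycle {m} m∈ = go (here refl)
    where
    go : ∀ {a b} → a ∈ cycleOf σ m → Reach f a b → b ∈ cycleOf σ m
    go a∈          ε          = a∈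
    go (here refl) (refl ◅ r) = go (chain-start (cycle-chain m∈)) r
    go (there a∈)  (refl ◅ r) = go (chain-closed (cycle-chain m∈) a∈) r

  reach-∈ : ∀ {a b} → a ∈ range n → Reach f a b → b ∈ range n
  reach-∈ a∈ ε          = a∈
  reach-∈ a∈ (refl ◅ r) = reach-∈ (app-∈ a∈) r

  -- Since b lies on the cycle of a, continuing the walk from b leads back to a.
  reach-sym : ∀ {a b} → a ∈ range n → Reach f a b → Reach f b a
  reach-sym a∈ r with reach⇒∈-cycle a∈ r
  ... | here refl = ε
  ... | there b∈  = let _ , c , _ = chain-suffix (cycle-chain a∈) b∈ in chain-end c

  isCycleMin⇒≤ : ∀ {m b} → m ∈ range n → T (isCycleMin σ m) → Reach f m b → m ≤ b
  isCycleMin⇒≤ {m} m∈ min r =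
    allGe⇒≤ (cycleOf σ m) (subst T (isCycleMin≡allGe σ m) min) (reach⇒∈-cycle m∈ r)

  ≤⇒isCycleMin : ∀ {m} → m ∈ range n → (∀ {b} → Reach f m b → m ≤ b) → T (isCycleMin σ m)
  ≤⇒isCycleMin {m} m∈ h = subst T (sym (isCycleMin≡allGe σ m))
    (≤⇒allGe (cycleOf σ m) (h ∘ ∈-cycle⇒reach m∈))

  -- Strong induction: an element that is not a cycle minimum has a smaller one in its cycle.
  cycleMin-exists : ∀ i → i ∈ range n → ∃ λ m → m ∈ range n × T (isCycleMin σ m) × Reach f m i
  cycleMin-exists = <-rec _ λ i rec i∈ → search i rec i∈ (T? (isCycleMin σ i))
    where
    search : ∀ i → (∀ {b} → b < i → b ∈ range n → ∃ λ m → m ∈ range n × T (isCycleMin σ m) × Reach f m b) →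
             i ∈ range n → Dec (T (isCycleMin σ i)) → ∃ λ m → m ∈ range n × T (isCycleMin σ m) × Reach f m i
    search i rec i∈ (yes min) = i , i∈ , min , ε
    search i rec i∈ (no ¬min) =
      let b , b∈ , b<i = ¬allGe⇒< (cycleOf σ i) (¬min ∘ subst T (sym (isCycleMin≡allGe σ i)))
          r = ∈-cycle⇒reach i∈ b∈
          m , m∈ , min , r′ = rec b<i (reach-∈ i∈ r)
      in m , m∈ , min , r′ ◅◅ reach-sym i∈ r

  cycleMin-unique : ∀ {m m′} → m ∈ range n → m′ ∈ range n → T (isCycleMin σ m) → T (isCycleMin σ m′) →
                    Reach f m m′ → m ≡ m′
  cycleMin-unique m∈ m′∈ min min′ r =
    ≤-antisym (isCycleMin⇒≤ m∈ min r) (isCycleMin⇒≤ m′∈ min′ (reach-sym m∈ r))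

  cycleMins : List ℕ
  cycleMins = filterᵇ (isCycleMin σ) (rangeDown (length σ))

  cycleMins-unique : Unique cycleMins
  cycleMins-unique rewrite filterᵇ≡filter (isCycleMin σ) (rangeDown (length σ)) =
    Unique.filter⁺ (T? ∘ isCycleMin σ) (rangeDown-unique (length σ))

  ∈-cycleMins⁻ : ∀ {m} → m ∈ cycleMins → m ∈ range n × T (isCycleMin σ m)
  ∈-cycleMins⁻ m∈ rewrite filterᵇ≡filter (isCycleMin σ) (rangeDown (length σ)) =
    let m∈′ , min = ∈-filter⁻ (T? ∘ isCycleMin σ) m∈
        1≤m , m≤ = ∈-rangeDown⁻ m∈′
    in ∈-range⁺ 1≤m (≤-trans m≤ (≤-reflexive length≡)) , min

  ∈-cycleMins⁺ : ∀ {m} → m ∈ range n → T (isCycleMin σ m) → m ∈ cycleMins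
  ∈-cycleMins⁺ m∈ min rewrite filterᵇ≡filter (isCycleMin σ) (rangeDown (length σ)) =
    let 1≤m , m≤n = ∈-range⁻ m∈ in
    ∈-filter⁺ (T? ∘ isCycleMin σ) (∈-rangeDown⁺ 1≤m (≤-trans m≤n (≤-reflexive (sym length≡)))) min

  cycleOf-unique : ∀ {m} → m ∈ range n → Unique (cycleOf σ m)
  cycleOf-unique m∈ =
    All.tabulate (λ b∈ → λ { refl → chain-≢ (cycle-chain m∈) b∈ refl }) ∷ chain-unique (cycle-chain m∈)

  cycles-disjoint : ∀ {m m′} → m ∈ cycleMins → m′ ∈ cycleMins → m ≢ m′ →
                    Disjoint (cycleOf σ m) (cycleOf σ m′)
  cycles-disjoint m∈ m′∈ m≢m′ (a∈ , a∈′) =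
    let m∈r , min = ∈-cycleMins⁻ m∈
        m′∈r , min′ = ∈-cycleMins⁻ m′∈
    in m≢m′ (cycleMin-unique m∈r m′∈r min min′
         (∈-cycle⇒reach m∈r a∈ ◅◅ reach-sym m′∈r (∈-cycle⇒reach m′∈r a∈′)))

  Ψ-unique : Unique (Ψ σ)
  Ψ-unique = Unique.concat⁺
    (All.map⁺ (All.tabulate (cycleOf-unique ∘ proj₁ ∘ ∈-cycleMins⁻)))
    (AllPairs.map⁺ (go id cycleMins-unique))
    where
    go : ∀ {ms} → ms ⊆ cycleMins → Unique ms → AllPairs (λ m m′ → Disjoint (cycleOf σ m) (cycleOf σ m′)) ms
    go sub []      = []
    go sub (x∉ ∷ u) = All.tabulate (λ m′∈ → cycles-disjoint (sub (here refl)) (sub (there m′∈)) (All.lookup x∉ m′∈))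
                     ∷ go (sub ∘ there) u

  -- Allows a product taken in the order of Ψ to be rearranged into one over 1, ..., n.
  Ψ-↭ : Ψ σ ↭ range n
  Ψ-↭ = unique-⊆-⊇⇒↭ Ψ-unique (range-unique n) sub sup
    where
    sub : Ψ σ ⊆ range n
    sub a∈ with ∈-concat⁻′ (standardCycleForm σ) a∈
    ... | w , a∈w , w∈ with ∈-map⁻ (cycleOf σ) w∈
    ...   | m , m∈ , refl = let m∈r , _ = ∈-cycleMins⁻ m∈ in reach-∈ m∈r (∈-cycle⇒reach m∈r a∈w)
    sup : range n ⊆ Ψ σ
    sup {i} i∈ = let m , m∈ , min , r = cycleMin-exists i i∈ in
      ∈-concat⁺′ (reach⇒∈-cycle m∈ r) (∈-map⁺ (cycleOf σ) (∈-cycleMins⁺ m∈ min))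

-- The weight of a permutation as a product over its letters

module _ {c ℓ} (R : CommutativeSemiring c ℓ) where
  open CommutativeSemiring R renaming (refl to ≈-refl; sym to ≈-sym; trans to ≈-trans)

  prodR : List Carrier → Carrier
  prodR = foldr _*_ 1#

  prod-↭ : ∀ (g : ℕ → Carrier) {is js} → is ↭ js → prodR (map g is) ≈ prodR (map g js)
  prod-↭ g is↭js =
    ↭ₛ.foldr-commMonoid setoid *-isCommutativeMonoid (↭⇒↭ₛ′ isEquivalence (↭.map⁺ g is↭js))

  prod-cong : ∀ {g h : ℕ → Carrier} is → (∀ {i} → i ∈ is → g i ≈ h i) →
              prodR (map g is) ≈ prodR (map h is)
  prod-cong []       g≈h = ≈-refl
  prod-cong (i ∷ is) g≈h = *-cong (g≈h (here refl)) (prod-cong is (g≈h ∘ there))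

  prod-++ : ∀ (g : ℕ → Carrier) is js →
            prodR (map g (is ++ js)) ≈ prodR (map g is) * prodR (map g js)
  prod-++ g []       js = ≈-sym (*-identityˡ _)
  prod-++ g (i ∷ is) js = ≈-trans (*-congˡ (prod-++ g is js)) (≈-sym (*-assoc _ _ _))

  sumR≡foldr : ∀ as → sumR R as ≡ foldr _+_ 0# as
  sumR≡foldr []       = refl
  sumR≡foldr (a ∷ as) = cong (a +_) (sumR≡foldr as)

  module _ {A : Set} where

    sum-↭ : ∀ (g : A → Carrier) {is js} → is ↭ js → sumR R (map g is) ≈ sumR R (map g js)
    sum-↭ g {is} {js} is↭js rewrite sumR≡foldr (map g is) | sumR≡foldr (map g js) =
      ↭ₛ.foldr-commMonoid setoid +-isCommutativeMonoid (↭⇒↭ₛ′ isEquivalence (↭.map⁺ g is↭js))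

    sum-cong : ∀ {g h : A → Carrier} is → (∀ {i} → i ∈ is → g i ≈ h i) →
               sumR R (map g is) ≈ sumR R (map h is)
    sum-cong []       g≈h = ≈-refl
    sum-cong (i ∷ is) g≈h = +-cong (g≈h (here refl)) (sum-cong is (g≈h ∘ there))

    sum-++ : ∀ (g : A → Carrier) is js →
             sumR R (map g (is ++ js)) ≈ sumR R (map g is) + sumR R (map g js)
    sum-++ g []       js = ≈-sym (+-identityˡ _)
    sum-++ g (i ∷ is) js = ≈-trans (+-congˡ (sum-++ g is js)) (≈-sym (+-assoc _ _ _))

    sum-linear : ∀ r (g h : A → Carrier) is →
                 sumR R (map (λ i → r * g i + h i) is) ≈ r * sumR R (map g is) + sumR R (map h is)
    sum-linear r g h []       = ≈-sym (≈-trans (+-identityʳ _) (zeroʳ _))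
    sum-linear r g h (i ∷ is) = ≈-trans (+-congˡ (sum-linear r g h is))
      (solve 5 (λ r g h s t → (r :* g :+ h) :+ (r :* s :+ t) := r :* (g :+ s) :+ (h :+ t))
        ≈-refl r (g i) (h i) (sumR R (map g is)) (sumR R (map h is)))
      where open Solver R using (solve; _:+_; _:*_; _:=_)

  sum-cartesianProductWith : ∀ {A B D : Set} (g : D → Carrier) (k : A → B → D) is js →
    sumR R (map g (cartesianProductWith k is js)) ≈ sumR R (map (λ i → sumR R (map (g ∘ k i) js)) is)
  sum-cartesianProductWith g k []       js = ≈-refl
  sum-cartesianProductWith g k (i ∷ is) js = ≈-trans
    (sum-++ g (map (k i) js) _)
    (+-cong (reflexive (cong (sumR R) (sym (map-∘ js)))) (sum-cartesianProductWith g k is js))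

module Weights {c ℓ} (R : CommutativeSemiring c ℓ) (p q x : CommutativeSemiring.Carrier R) where
  open CommutativeSemiring R renaming (refl to ≈-refl; sym to ≈-sym; trans to ≈-trans)
  open Solver R using (solve; _:*_; _:=_)
  open SetoidReasoning setoid

  weight : List ℕ → Carrier
  weight σ = (pow R p (des σ) * pow R q (asc σ)) * pow R x (cyc σ)

  -- The weight of an arrow into v that does not ascend.
  minWeight : List ℕ → ℕ → Carrier
  minWeight σ v = if isCycleMin σ v then x else p

  letterWeight : List ℕ → ℕ → Carrier
  letterWeight σ i = if i <ᵇ app σ i then q else minWeight σ (app σ i)

  wordWeight : List ℕ → List ℕ → Carrier
  wordWeight σ w = pow R p (desWord σ w) * pow R q (ascWord σ w)

  stepWeight : List ℕ → ℕ → ℕ → Carrier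
  stepWeight σ a b = (if sameCycle σ a b ∧ (b <ᵇ a) then p else 1#) *
                     (if sameCycle σ a b ∧ (a <ᵇ b) then q else 1#)

  pow-indicator : ∀ r (t : Bool) k → pow R r ((if t then 1 else 0) +ℕ k) ≈ (if t then r else 1#) * pow R r k
  pow-indicator r true  k = ≈-refl
  pow-indicator r false k = ≈-sym (*-identityˡ _)

  wordWeight-∷ : ∀ σ a b w → wordWeight σ (a ∷ b ∷ w) ≈ stepWeight σ a b * wordWeight σ (b ∷ w)
  wordWeight-∷ σ a b w = ≈-trans
    (*-cong (pow-indicator p (sameCycle σ a b ∧ (b <ᵇ a)) (desWord σ (b ∷ w)))
            (pow-indicator q (sameCycle σ a b ∧ (a <ᵇ b)) (ascWord σ (b ∷ w))))
    (solve 4 (λ a b c d → (a :* b) :* (c :* d) := (a :* c) :* (b :* d)) ≈-refl _ _ _ _)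

  module _ {n : ℕ} {σ : List ℕ} (σ↭ : σ ↭ range n) where
    open Orbits {n} σ↭
    private
      f = app σ
      wt = letterWeight σ
      W = wordWeight σ
      Π = λ is → prodR R (map wt is)

    -- The boundary between the cycle of m and the following word w contributes nothing, whichever
    -- letter of the cycle comes last.
    Detached : ℕ → List ℕ → Set ℓ
    Detached m w = ∀ {a} → Reach f m a → W (a ∷ w) ≈ W w

    -- Consecutive letters of a written cycle are a and f a, so an arrow that does not close the
    -- cycle is seen in Ψ as an ascent or a descent.
    ¬min⇒letterWeight≡stepWeight : ∀ {a} → a ∈ range n → a ≢ f a → ¬ T (isCycleMin σ (f a)) →
                                   wt a ≈ stepWeight σ a (f a)
    ¬min⇒letterWeight≡stepWeight {a} a∈ a≢fa ¬min
      with elem (f a) (cycleOf σ a) | ∈⇒elem (reach⇒∈-cycle a∈ (refl ◅ ε))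
         | a <ᵇ f a in lt | f a <ᵇ a in gt | isCycleMin σ (f a)
    ... | true | _ | true  | true  | _     =
      contradiction (<ᵇ⇒< a (f a) (subst T (sym lt) tt)) (<-asym (<ᵇ⇒< (f a) a (subst T (sym gt) tt)))
    ... | true | _ | true  | false | _     = ≈-sym (*-identityˡ q)
    ... | true | _ | false | true  | false = ≈-sym (*-identityʳ p)
    ... | true | _ | false | _     | true  = contradiction tt ¬min
    ... | true | _ | false | false | _     =
      contradiction (≤-antisym (≮⇒≥ (subst T gt ∘ <⇒<ᵇ)) (≮⇒≥ (subst T lt ∘ <⇒<ᵇ))) a≢fa

    min⇒letterWeight≡x : ∀ {a} → a ∈ range n → T (isCycleMin σ (f a)) → wt a ≈ x
    min⇒letterWeight≡x {a} a∈ min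
      with isCycleMin⇒≤ (app-∈ a∈) min (reach-sym a∈ (refl ◅ ε)) | a <ᵇ f a in lt | isCycleMin σ (f a) | min
    ... | _    | false | true | _ = ≈-refl
    ... | fa≤a | true  | _    | _ = contradiction (<ᵇ⇒< a (f a) (subst T (sym lt) tt)) (≤⇒≯ fa≤a)

    -- Walking along the cycle, each arrow is matched with an adjacent pair of Ψ. The last arrow,
    -- back to m, has no such pair and is paid for by the x of the cycle.
    chain-weight : ∀ {m a u} w → m ∈ range n → T (isCycleMin σ m) → Detached m w →
                   Reach f m a → Chain f m (f a) u →
                   x * W (a ∷ u ++ w) ≈ Π (a ∷ u) * W w
    chain-weight {m} {a} w m∈ min det r c = go r c refl
      where
      go : ∀ {a b u} → Reach f m a → Chain f m b u → f a ≡ b → x * W (a ∷ u ++ w) ≈ Π (a ∷ u) * W w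
      go {a} r stop fa≡m = *-cong
        (≈-sym (≈-trans (*-identityʳ _)
          (min⇒letterWeight≡x (reach-∈ m∈ r) (subst (T ∘ isCycleMin σ) (sym fa≡m) min))))
        (det r)
      go {a} {b} {u = .b ∷ u} r (step b≢m c) refl = begin
        x * W (a ∷ b ∷ u ++ w)
          ≈⟨ *-congˡ (wordWeight-∷ σ a b (u ++ w)) ⟩
        x * (stepWeight σ a b * W (b ∷ u ++ w))
          ≈⟨ solve 3 (λ a b c → a :* (b :* c) := b :* (a :* c)) ≈-refl _ _ _ ⟩
        stepWeight σ a b * (x * W (b ∷ u ++ w))
          ≈⟨ *-cong (≈-sym (¬min⇒letterWeight≡stepWeight a∈ a≢b ¬min)) (go r′ c refl) ⟩
        wt a * (Π (b ∷ u) * W w)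
          ≈⟨ *-assoc _ _ _ ⟨
        Π (a ∷ b ∷ u) * W w ∎
        where
        a∈ = reach-∈ m∈ r
        r′ : Reach f m b
        r′ = r ◅◅ (refl ◅ ε)
        ¬min : ¬ T (isCycleMin σ b)
        ¬min min′ = b≢m (sym (cycleMin-unique m∈ (reach-∈ m∈ r′) min min′ r′))
        -- If a = b, then b is a fixed point and both u and b ∷ u would be its chain to m.
        a≢b : a ≢ b
        a≢b a≡b = 1+n≢n (cong length (chain-functional (step b≢m c)
          (subst (λ z → Chain f m z u) (cong f (sym a≡b)) c)))

    cycles-weight : ∀ ms → ms ⊆ cycleMins → Unique ms →
      let w = concat (map (cycleOf σ) ms) in pow R x (length ms) * W w ≈ Π w
    cycles-weight []       sub u        = ≈-trans (*-identityˡ _) (*-identityˡ _)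
    cycles-weight (m ∷ ms) sub (m∉ ∷ u) = begin
      (x * pow R x (length ms)) * W (cycleOf σ m ++ w)
        ≈⟨ solve 3 (λ a b c → (a :* b) :* c := b :* (a :* c)) ≈-refl _ _ _ ⟩
      pow R x (length ms) * (x * W (cycleOf σ m ++ w))
        ≈⟨ *-congˡ (chain-weight w m∈ min (detached ms (sub ∘ there) m∉) ε (cycle-chain m∈)) ⟩
      pow R x (length ms) * (Π (cycleOf σ m) * W w)
        ≈⟨ solve 3 (λ a b c → a :* (b :* c) := b :* (a :* c)) ≈-refl _ _ _ ⟩
      Π (cycleOf σ m) * (pow R x (length ms) * W w)
        ≈⟨ *-congˡ (cycles-weight ms (sub ∘ there) u) ⟩
      Π (cycleOf σ m) * Π w
        ≈⟨ prod-++ R wt (cycleOf σ m) w ⟨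
      Π (cycleOf σ m ++ w) ∎
      where
      w = concat (map (cycleOf σ) ms)
      m∈ = proj₁ (∈-cycleMins⁻ (sub (here refl)))
      min = proj₂ (∈-cycleMins⁻ (sub (here refl)))
      -- The next word starts with a different cycle minimum, so `sameCycle` fails across the
      -- boundary.
      detached : ∀ ms → ms ⊆ cycleMins → All (m ≢_) ms → Detached m (concat (map (cycleOf σ) ms))
      detached []        _   _          _ = ≈-refl
      detached (m′ ∷ ms) sub (m≢m′ ∷ _) {a} r =
        ≈-trans (wordWeight-∷ σ a m′ (orbitGo σ m′ (f m′) (length σ) ++ concat (map (cycleOf σ) ms))) (≈-trans (*-congʳ trivial) (*-identityˡ _))
        where
        m′∈ = ∈-cycleMins⁻ (sub (here refl))
        trivial : stepWeight σ a m′ ≈ 1#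
        trivial with elem m′ (cycleOf σ a) in e
        ... | false = *-identityˡ 1#
        ... | true  = contradiction
          (cycleMin-unique m∈ (proj₁ m′∈) min (proj₂ m′∈)
            (r ◅◅ ∈-cycle⇒reach (reach-∈ m∈ r) (elem⇒∈ (cycleOf σ a) (subst T (sym e) tt))))
          m≢m′

    weight≈prod : weight σ ≈ Π (range n)
    weight≈prod = begin
      W (Ψ σ) * pow R x (cyc σ)
        ≈⟨ *-comm _ _ ⟩
      pow R x (cyc σ) * W (Ψ σ)
        ≈⟨ *-congʳ (reflexive (cong (pow R x) (length-map (cycleOf σ) cycleMins))) ⟩
      pow R x (length cycleMins) * W (Ψ σ)
        ≈⟨ cycles-weight cycleMins id cycleMins-unique ⟩
      Π (Ψ σ)
        ≈⟨ prod-↭ R wt Ψ-↭ ⟩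
      Π (range n) ∎

-- Cycles after an insertion

¬T⇒≡false : ∀ {b} → ¬ T b → b ≡ false
¬T⇒≡false {false} _ = refl
¬T⇒≡false {true}  h = contradiction tt h

T-extensional : ∀ {b b′} → (T b → T b′) → (T b′ → T b) → b ≡ b′
T-extensional h k = ⇔→≡ (mk⇔ (Equivalence.to T-≡ ∘ h ∘ Equivalence.from T-≡)
                             (Equivalence.to T-≡ ∘ k ∘ Equivalence.from T-≡))

module Insertion {n : ℕ} {σ : List ℕ} {v : ℕ} (σ↭ : σ ↭ range n) (v∈ : v ∈ range (suc n)) where
  open Orbits {n} σ↭

  private
    N = suc n
    τ = insert N σ v
    f = app σ
    g = app τ
    module τ = Orbits {N} (insert-perm {n} {σ} σ↭ v∈)

  ∈-weaken : ∀ {i} → i ∈ range n → i ∈ range N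
  ∈-weaken = ∈-++⁺ˡ

  app-insert : ∀ {j} → j ∈ range n → g j ≡ transp v N (f j)
  app-insert j∈ = let 1≤j , j≤n = ∈-range⁻ j∈ in trans
    (app-∷ʳ {map (transp v N) σ} (≤-trans j≤n (≤-reflexive (sym (trans (length-map _ σ) length≡)))))
    (app-map (transp v N) {σ} 1≤j (≤-trans j≤n (≤-reflexive (sym length≡))))

  app-insert-new : g N ≡ v
  app-insert-new = trans (cong (g ∘ suc) (sym (trans (length-map _ σ) length≡)))
                         (app-last (map (transp v N) σ) v)

  app-insert-same : ∀ {j} → j ∈ range n → f j ≢ v → g j ≡ f j
  app-insert-same j∈ fj≢v = trans (app-insert j∈) (transp-other fj≢v
    (λ fj≡N → 1+n≰n (≤-trans (≤-reflexive (sym fj≡N)) (proj₂ (∈-range⁻ (app-∈ j∈))))))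

  app-insert-split : ∀ {j} → j ∈ range n → f j ≡ v → g j ≡ N
  app-insert-split j∈ refl = trans (app-insert j∈) (transp-left v N)

  reach⇒reach-insert : ∀ {a b} → a ∈ range n → Reach f a b → Reach g a b
  reach⇒reach-insert a∈ ε = ε
  reach⇒reach-insert {a} a∈ (refl ◅ r) with f a ≟ v
  ... | no fa≢v  = app-insert-same a∈ fa≢v ◅ reach⇒reach-insert (app-∈ a∈) r
  ... | yes fa≡v = app-insert-split a∈ fa≡v ◅ trans app-insert-new (sym fa≡v)
                   ◅ reach⇒reach-insert (app-∈ a∈) r

  -- Removing N from a walk of the new permutation leaves a walk of the old one, unless the walk
  -- ends in N.
  reach-insert⇒reach : ∀ {a b} → a ∈ range n → Reach g a b → Reach f a b ⊎ b ≡ N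
  reach-insert⇒reach a∈ ε = inj₁ ε
  reach-insert⇒reach {a} a∈ (ga≡ ◅ r) with f a ≟ v
  reach-insert⇒reach {a} {b} a∈ (ga≡ ◅ r) | no fa≢v
    with refl ← trans (sym ga≡) (app-insert-same a∈ fa≢v) =
    Sum.map₁ (refl ◅_) (reach-insert⇒reach (app-∈ a∈) r)
  reach-insert⇒reach {a} a∈ (ga≡ ◅ ε) | yes fa≡v = inj₂ (trans (sym ga≡) (app-insert-split a∈ fa≡v))
  -- The detour from a through N to v collapses to the single old arrow from a to v.
  reach-insert⇒reach {a} a∈ (ga≡ ◅ gga≡ ◅ r) | yes fa≡v
    with refl ← trans (sym gga≡) (trans (cong g (trans (sym ga≡) (app-insert-split a∈ fa≡v)))
                                        (trans app-insert-new (sym fa≡v))) =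
    Sum.map₁ (refl ◅_) (reach-insert⇒reach (app-∈ a∈) r)

  -- An old cycle can only gain n+1, which is too large to affect its minimum.
  isCycleMin-insert : ∀ {m} → m ∈ range n → isCycleMin τ m ≡ isCycleMin σ m
  isCycleMin-insert {m} m∈ = T-extensional to from
    where
    to : T (isCycleMin τ m) → T (isCycleMin σ m)
    to min = ≤⇒isCycleMin m∈ (τ.isCycleMin⇒≤ (∈-weaken m∈) min ∘ reach⇒reach-insert m∈)
    from : T (isCycleMin σ m) → T (isCycleMin τ m)
    from min = τ.≤⇒isCycleMin (∈-weaken m∈) λ r → case reach-insert⇒reach m∈ r of λ
      { (inj₁ r′)   → isCycleMin⇒≤ m∈ min r′
      ; (inj₂ refl) → m≤n⇒m≤1+n (proj₂ (∈-range⁻ m∈)) }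

isCycleMin-insert-new : ∀ {n σ} → σ ↭ range n → T (isCycleMin (insert (suc n) σ (suc n)) (suc n))
isCycleMin-insert-new {n} {σ} σ↭ = τ.≤⇒isCycleMin N∈ (≤-reflexive ∘ fixed)
  where
  N = suc n
  N∈ : N ∈ range N
  N∈ = ∈-range⁺ (s≤s z≤n) ≤-refl
  module τ = Orbits {N} (insert-perm {n} {σ} σ↭ N∈)
  fixed : ∀ {b} → Reach (app (insert N σ N)) N b → N ≡ b
  fixed ε = refl
  fixed (eq ◅ r) with refl ← trans (sym eq) (Insertion.app-insert-new {n} {σ} σ↭ N∈) = fixed r

-- Insertion as a derivation on weights

module _ {c ℓ} (R : CommutativeSemiring c ℓ) (p q x : CommutativeSemiring.Carrier R) where
  open CommutativeSemiring R renaming (refl to ≈-refl; sym to ≈-sym; trans to ≈-trans)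
  open Solver R using (solve; _:*_; _:=_)
  open SetoidReasoning setoid
  open Weights R p q x
  private
    Rε = dualNumbers R
    module Rε = CommutativeSemiring Rε
    module Wε = Weights Rε (pε R p q x) (qε R p q x) (xε R p q x)

  -- The letter weights after n+1 is inserted behind i: the arrow out of i now ascends.
  modified : (w : ℕ → Carrier) → ℕ → ℕ → Carrier
  modified w i j = if j ≡ᵇ i then q else w j

  modified-same : ∀ w i → modified w i i ≈ q
  modified-same w i with i ≡ᵇ i | ≡⇒≡ᵇ i i refl
  ... | true | _ = ≈-refl

  modified-other : ∀ w {i j} → j ≢ i → modified w i j ≈ w j
  modified-other w {i} {j} j≢i with j ≡ᵇ i in eq
  ... | true  = contradiction (≡ᵇ⇒≡ j i (subst T (sym eq) tt)) j≢i
  ... | false = ≈-refl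

  -- The product rule when the derivative of w i is q * y i: the q takes the place of the factor w i
  -- and y i is split off as the weight of the new letter. Uniqueness ensures that `modified` alters
  -- exactly one factor.
  leibniz : ∀ (w y : ℕ → Carrier) {is} → Unique is →
    sumR R (map (λ i → prodR R (map (modified w i) is) * y i) is) ≈
    proj₂ (prodR Rε (map (λ i → w i , q * y i) is))
  leibniz w y [] = ≈-refl
  leibniz w y {i ∷ is} (i∉ ∷ u) = begin
    (modified w i i * prodR R (map (modified w i) is)) * y i +
      sumR R (map (λ j → (modified w j i * prodR R (map (modified w j) is)) * y j) is)
      ≈⟨ +-cong
           (*-congʳ (*-cong (modified-same w i)
             (prod-cong R is λ j∈ → modified-other w λ { refl → All.lookup i∉ j∈ refl })))
           (sum-cong R is λ j∈ → ≈-trans (*-assoc _ _ _) (*-congʳ (modified-other w (All.lookup i∉ j∈)))) ⟩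
    (q * prodR R (map w is)) * y i +
      sumR R (map (λ j → w i * (prodR R (map (modified w j) is) * y j)) is)
      ≈⟨ +-congˡ (scale is) ⟩
    (q * prodR R (map w is)) * y i +
      w i * sumR R (map (λ j → prodR R (map (modified w j) is) * y j) is)
      ≈⟨ +-cong (solve 3 (λ q a y → (q :* a) :* y := (q :* y) :* a) ≈-refl _ _ _) (*-congˡ (leibniz w y u)) ⟩
    (q * y i) * prodR R (map w is) + w i * proj₂ (prodR Rε (map (λ i → w i , q * y i) is))
      ≈⟨ ≈-trans (+-comm _ _) (+-congˡ (*-congˡ (reflexive (sym (value is))))) ⟩
    w i * proj₂ (prodR Rε (map (λ i → w i , q * y i) is)) +
      (q * y i) * proj₁ (prodR Rε (map (λ i → w i , q * y i) is)) ∎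
    where
    value : ∀ is → proj₁ (prodR Rε (map (λ i → w i , q * y i) is)) ≡ prodR R (map w is)
    value []       = refl
    value (i ∷ is) = cong (w i *_) (value is)
    scale : ∀ {h : ℕ → Carrier} js → sumR R (map (λ j → w i * h j) js) ≈ w i * sumR R (map h js)
    scale []       = ≈-sym (zeroʳ _)
    scale (j ∷ js) = ≈-trans (+-congˡ (scale js)) (≈-sym (distribˡ _ _ _))

  letterWeight-at : ∀ τ {j a} → app τ j ≡ a → letterWeight τ j ≡ (if j <ᵇ a then q else minWeight τ a)
  letterWeight-at τ refl = refl

  module _ {n : ℕ} {σ : List ℕ} (σ↭ : σ ↭ range n) where
    open Orbits {n} σ↭
    private
      N = suc n
      f = app σ
      Π : (ℕ → Carrier) → Carrier
      Π w = prodR R (map w (range n))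

    weight-insert : ∀ {v} → v ∈ range N → let τ = insert N σ v in
                    weight τ ≈ Π (letterWeight τ) * minWeight τ v
    weight-insert {v} v∈ = begin
      weight τ
        ≈⟨ weight≈prod {N} (insert-perm {n} {σ} σ↭ v∈) ⟩
      prodR R (map (letterWeight τ) (range n ∷ʳ N))
        ≈⟨ prod-++ R (letterWeight τ) (range n) [ N ] ⟩
      Π (letterWeight τ) * (letterWeight τ N * 1#)
        ≈⟨ *-congˡ (≈-trans (*-identityʳ _) (reflexive last)) ⟩
      Π (letterWeight τ) * minWeight τ v ∎
      where
      τ = insert N σ v
      -- No arrow out of the largest letter N ascends.
      last : letterWeight τ N ≡ minWeight τ v
      last = trans (letterWeight-at τ (Insertion.app-insert-new {n} {σ} σ↭ v∈))
        (cong (if_then q else minWeight τ v)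
          (¬T⇒≡false (λ N<v → ≤⇒≯ (proj₂ (∈-range⁻ v∈)) (<ᵇ⇒< N v N<v))))

    minWeight-insert : ∀ {v m} → v ∈ range N → m ∈ range n →
                       minWeight (insert N σ v) m ≡ minWeight σ m
    minWeight-insert v∈ m∈ =
      cong (if_then x else p) (Insertion.isCycleMin-insert {n} {σ} σ↭ v∈ m∈)

    letterWeight-same : ∀ {v j} → v ∈ range N → j ∈ range n → f j ≢ v →
                        letterWeight (insert N σ v) j ≡ letterWeight σ j
    letterWeight-same {v} {j} v∈ j∈ fj≢v = trans
      (letterWeight-at (insert N σ v) (Insertion.app-insert-same {n} {σ} σ↭ v∈ j∈ fj≢v))
      (cong (if j <ᵇ f j then q else_) (minWeight-insert v∈ (app-∈ j∈)))

    letterWeight-split : ∀ {v j} → v ∈ range N → j ∈ range n → f j ≡ v →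
                         letterWeight (insert N σ v) j ≡ q
    letterWeight-split {v} {j} v∈ j∈ fj≡v = trans
      (letterWeight-at (insert N σ v) (Insertion.app-insert-split {n} {σ} σ↭ v∈ j∈ fj≡v))
      (cong (if_then q else minWeight (insert N σ v) N)
        (Equivalence.to T-≡ (<⇒<ᵇ (s≤s (proj₂ (∈-range⁻ j∈))))))

    weight-insert-new : weight (insert N σ N) ≈ x * weight σ
    weight-insert-new = begin
      weight (insert N σ N)
        ≈⟨ weight-insert N∈ ⟩
      Π (letterWeight (insert N σ N)) * minWeight (insert N σ N) N
        ≈⟨ *-cong (prod-cong R (range n) λ j∈ → reflexive (letterWeight-same N∈ j∈ (fj≢N j∈))) (reflexive newMin) ⟩
      Π (letterWeight σ) * x
        ≈⟨ ≈-trans (*-comm _ _) (*-congˡ (≈-sym (weight≈prod {n} σ↭))) ⟩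
      x * weight σ ∎
      where
      N∈ : N ∈ range N
      N∈ = ∈-range⁺ (s≤s z≤n) ≤-refl
      fj≢N : ∀ {j} → j ∈ range n → f j ≢ N
      fj≢N j∈ eq = 1+n≰n (≤-trans (≤-reflexive (sym eq)) (proj₂ (∈-range⁻ (app-∈ j∈))))
      newMin : minWeight (insert N σ N) N ≡ x
      newMin = cong (if_then x else p) (Equivalence.to T-≡ (isCycleMin-insert-new {n} {σ} σ↭))

    -- Naming the place by the predecessor i of v shows, by injectivity of σ, that i is the only old
    -- letter whose factor changes.
    weight-insert-old : ∀ {i} → i ∈ range n →
      weight (insert N σ (f i)) ≈ Π (modified (letterWeight σ) i) * minWeight σ (f i)
    weight-insert-old {i} i∈ = ≈-trans (weight-insert v∈)
      (*-cong (prod-cong R (range n) factor)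
              (reflexive (minWeight-insert v∈ (app-∈ i∈))))
      where
      v∈ = ∈-++⁺ˡ (app-∈ i∈)
      factor : ∀ {j} → j ∈ range n →
               letterWeight (insert N σ (f i)) j ≈ modified (letterWeight σ) i j
      factor {j} j∈ with j ≟ i
      ... | yes refl = ≈-trans (reflexive (letterWeight-split v∈ j∈ refl)) (≈-sym (modified-same (letterWeight σ) i))
      ... | no j≢i   = ≈-trans (reflexive (letterWeight-same v∈ j∈ (j≢i ∘ app-injective j∈ i∈)))
                               (≈-sym (modified-other (letterWeight σ) j≢i))

    -- The ε-parts of the three values are q times the weight of an inserted n+1. For the value q
    -- this weight is p, because an ascent cannot end in a cycle minimum.
    letterWeight-dual : ∀ {i} → i ∈ range n →
      Wε.letterWeight σ i Rε.≈ (letterWeight σ i , q * minWeight σ (f i))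
    letterWeight-dual {i} i∈ with i <ᵇ f i in lt | isCycleMin σ (f i) in min
    ... | false | true  = Rε.refl
    ... | false | false = Rε.refl
    ... | true  | false = Rε.refl
    ... | true  | true  = contradiction (<ᵇ⇒< i (f i) (subst T (sym lt) tt))
      (≤⇒≯ (isCycleMin⇒≤ (app-∈ i∈) (subst T (sym min) tt) (reach-sym i∈ (refl ◅ ε))))

    sum-weight-insert : sumR R (map (weight ∘ insert N σ) (range N)) ≈ x * weight σ + proj₂ (Wε.weight σ)
    sum-weight-insert = begin
      sumR R (map (weight ∘ insert N σ) (range n ∷ʳ N))
        ≈⟨ sum-++ R (weight ∘ insert N σ) (range n) [ N ] ⟩
      sumR R (map (weight ∘ insert N σ) (range n)) + (weight (insert N σ N) + 0#)
        ≈⟨ ≈-trans (+-comm _ _) (+-congʳ (≈-trans (+-identityʳ _) weight-insert-new)) ⟩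
      x * weight σ + sumR R (map (weight ∘ insert N σ) (range n))
        -- Change of variable v = σ(i): the places are summed over the predecessor i.
        ≈⟨ +-congˡ (sum-↭ R (weight ∘ insert N σ) (↭-trans (↭-sym σ↭) (↭-reflexive (sym map-app)))) ⟩
      x * weight σ + sumR R (map (weight ∘ insert N σ) (map f (range n)))
        ≈⟨ +-congˡ (reflexive (cong (sumR R) (sym (map-∘ (range n))))) ⟩
      x * weight σ + sumR R (map (weight ∘ insert N σ ∘ f) (range n))
        ≈⟨ +-congˡ (sum-cong R (range n) weight-insert-old) ⟩
      x * weight σ + sumR R (map (λ i → Π (modified (letterWeight σ) i) * minWeight σ (f i)) (range n))
        ≈⟨ +-congˡ (leibniz (letterWeight σ) (minWeight σ ∘ f) (range-unique n)) ⟩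
      x * weight σ + proj₂ (prodR Rε (map (λ i → letterWeight σ i , q * minWeight σ (f i)) (range n)))
        ≈⟨ +-congˡ (proj₂ (Rε.trans (Wε.weight≈prod {n} σ↭) (prod-cong Rε (range n) letterWeight-dual))) ⟨
      x * weight σ + proj₂ (Wε.weight σ) ∎

  permGF-suc : ∀ n → permGF R p q x (suc n) ≈
    x * permGF R p q x n + proj₂ (permGF Rε (pε R p q x) (qε R p q x) (xε R p q x) n)
  permGF-suc n = begin
    permGF R p q x (suc n)
      ≈⟨ sum-↭ R weight (Perms-suc n) ⟩
    sumR R (map weight (cartesianProductWith (insert (suc n)) (Perms n) (range (suc n))))
      ≈⟨ sum-cartesianProductWith R weight (insert (suc n)) (Perms n) (range (suc n)) ⟩
    sumR R (map (λ σ → sumR R (map (weight ∘ insert (suc n) σ) (range (suc n)))) (Perms n))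
      ≈⟨ sum-cong R (Perms n) (λ σ∈ → sum-weight-insert {n} (∈-Perms⁻ {n} σ∈)) ⟩
    sumR R (map (λ σ → x * weight σ + proj₂ (Wε.weight σ)) (Perms n))
      ≈⟨ sum-linear R x weight (proj₂ ∘ Wε.weight) (Perms n) ⟩
    x * permGF R p q x n + sumR R (map (proj₂ ∘ Wε.weight) (Perms n))
      ≈⟨ +-congˡ (reflexive (proj₂-sum (Perms n))) ⟩
    x * permGF R p q x n + proj₂ (permGF Rε (pε R p q x) (qε R p q x) (xε R p q x) n) ∎
    where
    proj₂-sum : ∀ σs → sumR R (map (proj₂ ∘ Wε.weight) σs) ≡ proj₂ (sumR Rε (map Wε.weight σs))
    proj₂-sum []       = refl
    proj₂-sum (σ ∷ σs) = cong (proj₂ (Wε.weight σ) +_) (proj₂-sum σs)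

-- Comparison of the two recursions

permGF≈motzkin : ∀ {c ℓ} (R : CommutativeSemiring c ℓ) (p q x : CommutativeSemiring.Carrier R) n →
                 CommutativeSemiring._≈_ R (permGF R p q x n) (motzkin R p q x n 0)
permGF≈motzkin R p q x zero    = ≈-trans (+-identityʳ _) (≈-trans (*-identityʳ _) (*-identityʳ _))
  where open CommutativeSemiring R renaming (trans to ≈-trans)
permGF≈motzkin R p q x (suc n) = ≈-trans (permGF-suc R p q x n) (≈-trans
    (+-cong (*-congˡ (permGF≈motzkin R p q x n))
            -- δ applied to the induction hypothesis.
            (proj₂ (permGF≈motzkin (dualNumbers R) (pε R p q x) (qε R p q x) (xε R p q x) n)))
    (≈-sym (motzkin-suc R p q x n)))
  where open CommutativeSemiring R renaming (trans to ≈-trans; sym to ≈-sym)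

mainTheorem2 : ∀ {c ℓ} (R : CommutativeSemiring c ℓ) (p q x : CommutativeSemiring.Carrier R) (n N : ℕ) → n ≤ N → CommutativeSemiring._≈_ R (permGF R p q x n) (cfTrunc R p q x N 0 n)
mainTheorem2 R p q x n N n≤N =
  CommutativeSemiring.trans R (permGF≈motzkin R p q x n) (motzkin≈descent R p q x n N 0 n≤N)
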